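{- Let $G$ be a connected bipartite graph with at least $3$ vertices. Then \[ \mathcal{H}_G=[1,\infty),\qquad [2,\infty)\subset\mathcal{H}^\phi_G\subset[1,\infty),\qquad \{1\}\cup[3,\infty)\subset\mathcal{H}^\psi_G\subset[1,\infty). \] If moreover $K_{2,2}\subset G\subset K_{2,m}$ for some $m\ge2$, then $\mathcal{H}^\phi_G=[2,\infty)$ and $\{1\}\cup[2,\infty)\subset\mathcal{H}^\psi_G\subset[1,\infty)$.
   Context: Graphs are finite and simple; $K_{a,b}$ is the complete bipartite graph, and $\subset$ between graphs means subgraph containment (up to isomorphism). For a graph $G$ on $\{1,\dots,n\}$ and $I\subset\mathbb{R}$, $\mathcal{P}_G(I)$ is the set of real symmetric PSD $n\times n$ matrices with entries in $I$ and $a_{ij}=0$ whenever $i\ne j$ and $(i,j)$ is not an edge; $\mathcal{P}_G=\mathcal{P}_G(\mathbb{R})$. $A^{\circ\alpha}=(a_{ij}^\alpha)$ with $0^\alpha:=0$; $\psi_\alpha(x)=\mathrm{sgn}(x)|x|^\alpha$, $\phi_\alpha(x)=|x|^\alpha$ ($x\ne0$), $\psi_\alpha(0)=\phi_\alpha(0)=0$, applied entrywise. $\mathcal{H}_G=\{\alpha\in\mathbb{R}:A^{\circ\alpha}\in\mathcal{P}_G\ \forall A\in\mathcal{P}_G([0,\infty))\}$, $\mathcal{H}_G^\psi=\{\alpha:\psi_\alpha[A]\in\mathcal{P}_G\ \forall A\in\mathcal{P}_G(\mathbb{R})\}$, $\mathcal{H}_G^\phi=\{\alpha:\phi_\alpha[A]\in\mathcal{P}_G\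 \forall A\in\mathcal{P}_G(\mathbb{R})\}$. -}

module Defs where

open import Algebra.Bundles using (CommutativeRing)
open import Algebra.Definitions using (Congruent₂)
open import Data.Bool.Base using (Bool; if_then_else_)
open import Data.Fin.Base using (Fin; toℕ)
open import Data.Nat.Base as ℕ using (ℕ)
import Data.Nat.Properties as ℕ
open import Data.Product.Base using (_×_; _,_; ∃; ∃-syntax)
open import Data.Sum.Base as Sum using (_⊎_; inj₁; inj₂)
open import Function.Definitions using (Injective)
open import Level using (0ℓ)
open import Relation.Binary.Construct.Closure.ReflexiveTransitive using (Star)
import Relation.Binary.Construct.NonStrictToStrict as NonStrictToStrict
open import Relation.Binary.Core using (Rel)
open import Relation.Binary.Definitions using (Decidable; Irreflexive; Symmetric)
open import Relation.Binary.PropositionalEquality.Core using (_≡_; _≢_; refl)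
open import Relation.Binary.Structures using (IsDecTotalOrder)
open import Relation.Nullary.Decidable using (does; _×-dec_; _⊎-dec_)
open import Relation.Nullary.Negation using (¬_)
open import Relation.Unary using (Pred; Satisfiable; U)

------------------------------------------------------------------------
-- Real numbers

-- The real numbers are treated axiomatically, as a Dedekind-complete ordered
-- field; classically this determines them up to unique isomorphism.  The order
-- is decidable and suprema exist for arbitrary predicates, so this is the
-- classical real line.

record CompleteOrderedField : Set₁ where
  infix 4 _≤_
  field
    commutativeRing : CommutativeRing 0ℓ 0ℓ

  open CommutativeRing commutativeRing public

  field
    0≉1             : ¬ 0# ≈ 1#
    inverse         : ∀ x → ¬ x ≈ 0# → ∃[ y ] x * y ≈ 1#
    _≤_             : Rel Carrier 0ℓ
    isDecTotalOrder : IsDecTotalOrder _≈_ _≤_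
    +-monoˡ-≤       : ∀ z {x y} → x ≤ y → x + z ≤ y + z
    *-nonneg        : ∀ {x y} → 0# ≤ x → 0# ≤ y → 0# ≤ x * y

  UpperBound : Pred Carrier 0ℓ → Pred Carrier 0ℓ
  UpperBound P b = ∀ x → P x → x ≤ b

  field
    supremum : ∀ (P : Pred Carrier 0ℓ) → Satisfiable P → Satisfiable (UpperBound P) →
               ∃[ s ] UpperBound P s × (∀ b → UpperBound P b → s ≤ b)

  open IsDecTotalOrder isDecTotalOrder public using (_≟_; _≤?_)
  open NonStrictToStrict _≈_ _≤_ public using (_<_)

-- Exponentiation x ^ α for x > 0 and arbitrary real α.  For each x > 0 the map
-- α ↦ x ^ α is the unique homomorphism from the additive group of reals to the
-- multiplicative group of positive reals that sends 1 to x and is monotone;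
-- monotonicity need only be demanded for x > 1, since (x * y) ^ α ≈ x ^ α * y ^ α
-- relates x to its inverse.  Values at bases x ≤ 0 are junk.

record RealPower (ℝ : CompleteOrderedField) : Set where
  open CompleteOrderedField ℝ
  infixr 8 _^_
  field
    _^_            : Carrier → Carrier → Carrier
    ^-cong         : Congruent₂ _≈_ _^_
    ^-positive     : ∀ {x} α → 0# < x → 0# < x ^ α
    ^-identityʳ    : ∀ {x} → 0# < x → x ^ 1# ≈ x
    ^-distribˡ-+-* : ∀ {x} α β → 0# < x → x ^ (α + β) ≈ x ^ α * x ^ β
    ^-distribʳ-*   : ∀ {x y} α → 0# < x → 0# < y → (x * y) ^ α ≈ x ^ α * y ^ α
    ^-monoʳ-<      : ∀ {x α β} → 1# < x → α < β → x ^ α < x ^ β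

------------------------------------------------------------------------
-- Graphs

record Graph (n : ℕ) : Set₁ where
  field
    Adj    : Rel (Fin n) 0ℓ
    adj?   : Decidable Adj
    irrefl : Irreflexive _≡_ Adj
    sym    : Symmetric Adj

open Graph public using (Adj)

Connected : ∀ {n} → Graph n → Set
Connected G = ∀ i j → Star (Adj G) i j

Bipartite : ∀ {n} → Graph n → Set
Bipartite {n} G = ∃ λ (side : Fin n → Bool) → ∀ {i j} → Adj G i j → side i ≢ side j

-- Not necessarily induced subgraphs, up to isomorphism.
infix 4 _⊑_
_⊑_ : ∀ {m n} → Graph m → Graph n → Set
_⊑_ {m} {n} H G =
  ∃[ f ] Injective _≡_ _≡_ f × (∀ {i j} → Adj H i j → Adj G (f i) (f j))

-- The parts of the complete bipartite graph K a b are the first a and the last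
-- b vertices.
Cross : ∀ a b → Rel (Fin (a ℕ.+ b)) 0ℓ
Cross a b i j = toℕ i ℕ.< a × a ℕ.≤ toℕ j

cross? : ∀ a b → Decidable (Cross a b)
cross? a b i j = (toℕ i ℕ.<? a) ×-dec (a ℕ.≤? toℕ j)

K : ∀ a b → Graph (a ℕ.+ b)
K a b = record
  { Adj    = λ i j → Cross a b i j ⊎ Cross a b j i
  ; adj?   = λ i j → cross? a b i j ⊎-dec cross? a b j i
  ; irrefl = λ { refl (inj₁ (i<a , a≤i)) → ℕ.<⇒≱ i<a a≤i
               ; refl (inj₂ (i<a , a≤i)) → ℕ.<⇒≱ i<a a≤i }
  ; sym    = Sum.swap
  }

------------------------------------------------------------------------
-- Entrywise powers preserving positivity

module Powers (ℝ : CompleteOrderedField) (pow : RealPower ℝ) where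
  open CompleteOrderedField ℝ
  open RealPower pow
  open import Algebra.Properties.CommutativeMonoid.Sum +-commutativeMonoid using (sum)

  Matrix : ℕ → Set
  Matrix n = Fin n → Fin n → Carrier

  record PSD {n} (A : Matrix n) : Set where
    field
      symmetric : ∀ i j → A i j ≈ A j i
      nonneg    : ∀ (x : Fin n → Carrier) →
                  0# ≤ sum (λ i → sum (λ j → x i * A i j * x j))

  record 𝒫 {n} (G : Graph n) (I : Pred Carrier 0ℓ) (A : Matrix n) : Set where
    field
      psd       : PSD A
      entries∈I : ∀ i j → I (A i j)
      support   : ∀ i j → i ≢ j → ¬ Adj G i j → A i j ≈ 0#

  infixl 9 _[_]
  _[_] : ∀ {n} → (Carrier → Carrier) → Matrix n → Matrix n
  f [ A ] = λ i j → f (A i j)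

  2# 3# : Carrier
  2# = 1# + 1#
  3# = 2# + 1#

  [_,∞⟩ : Carrier → Pred Carrier 0ℓ
  [ a ,∞⟩ x = a ≤ x

  -- Singleton up to _≈_ (the library's ｛_｝ is up to _≡_).
  ⟦_⟧ : Carrier → Pred Carrier 0ℓ
  ⟦ a ⟧ x = x ≈ a

  ∣_∣ : Carrier → Carrier
  ∣ x ∣ = if does (0# ≤? x) then x else - x

  sgn : Carrier → Carrier
  sgn x = if does (x ≟ 0#) then 0# else (if does (0# ≤? x) then 1# else - 1#)

  -- x ^ α for x ≥ 0, with 0 ^ α = 0 for every α, including α ≤ 0.
  power : Carrier → Carrier → Carrier
  power α x = if does (x ≟ 0#) then 0# else x ^ α

  φ ψ : Carrier → Carrier → Carrier
  φ α x = if does (x ≟ 0#) then 0# else ∣ x ∣ ^ α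
  ψ α x = if does (x ≟ 0#) then 0# else sgn x * ∣ x ∣ ^ α

  -- The exponents α for which the entrywise map f α sends 𝒫 G I into 𝒫 G ℝ.
  Preserving : ∀ {n} → (Carrier → Carrier → Carrier) → Graph n → Pred Carrier 0ℓ →
               Pred Carrier 0ℓ
  Preserving f G I α = ∀ A → 𝒫 G I A → 𝒫 G U (f α [ A ])

  ℋ ℋφ ℋψ : ∀ {n} → Graph n → Pred Carrier 0ℓ
  ℋ  G = Preserving power G [ 0# ,∞⟩
  ℋφ G = Preserving φ G U
  ℋψ G = Preserving ψ G U

{-# OPTIONS --safe #-}

-- Lower bounds.  A quadratic form supported on a bipartite graph is bounded
-- below by its value on a vector whose signs are opposite on the two sides, so
-- off-diagonal entries matter only through an upper bound on their absolute
-- values.  For A ≥ 0 and α ≥ 1 the 2 × 2 minors give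
-- aᵢⱼ^α ≤ aᵢᵢ^β aᵢⱼ aⱼⱼ^β with β = (α − 1) / 2, whence A^∘α is positive together
-- with A.  Since φ_α[A] = (A ∘ A)^∘(α/2), the Schur product theorem yields the
-- case of φ_α for α ≥ 2; and ψ_α[A] has the same absolute values as φ_α[A].
--
-- Upper bounds.  Preservers are inherited by subgraphs.  A connected graph with
-- at least 3 vertices contains K₁₂, where an explicit matrix forces 2^α ≥ 2; on
-- K₂₂ a matrix with an entry −1 forces 2^α ≥ 4 for φ_α.
module Submission where

open import Data.Nat.Base as ℕ using (ℕ; zero; suc; s≤s; z≤n)
open import Data.Product.Base using (_×_; _,_; proj₁; proj₂; ∃; ∃₂; ∃-syntax)
open import Relation.Unary using (Pred; U; _⊆_; _≐_; _∪_)
open import Defs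

open import Algebra.Bundles using (CommutativeRing)
import Algebra.Properties.AbelianGroup
import Algebra.Properties.Ring
import Algebra.Properties.Semiring.Mult.TCOptimised
import Algebra.Properties.Semiring.Sum
import Algebra.Solver.Ring
open import Algebra.Solver.Ring.AlmostCommutativeRing using (fromCommutativeRing; _-Raw-AlmostCommutative⟶_)
open import Data.Bool.Base using (Bool; true; false; if_then_else_)
import Data.Bool.Properties as Bool
open import Data.Fin.Base using (Fin; zero; suc; punchIn)
open import Data.Fin.Patterns using (0F; 1F; 2F; 3F)
open import Data.Fin.Properties using (any?; punchInᵢ≢i) renaming (_≟_ to _≟ᶠ_)
open import Data.Integer.Base as ℤ using (ℤ; +_; -[1+_])
import Data.Integer.Properties as ℤ
open import Data.Maybe.Base as Maybe using (Maybe)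
import Data.Nat.Properties as ℕ
open import Data.Sum.Base as Sum using (_⊎_; inj₁; inj₂; [_,_]′)
open import Function.Base using (_∘_; case_of_)
open import Function.Definitions using (Injective)
open import Level using (0ℓ)
open import Relation.Binary.Bundles using (Poset)
open import Relation.Binary.Construct.Closure.ReflexiveTransitive using (Star; _◅_; ε)
open import Relation.Binary.Core using (Rel)
open import Relation.Binary.PropositionalEquality.Core as ≡ using (_≡_; _≢_)
import Relation.Binary.Reasoning.PartialOrder
import Relation.Binary.Reasoning.Setoid
open import Relation.Binary.Structures using (IsDecTotalOrder)
open import Relation.Nullary.Decidable using (does; yes; no; dec⇒maybe; _⊎-dec_)
open import Relation.Nullary.Negation using (¬_; contradiction)
import Relation.Unary as Unary

-- The sign-flipped test vector sees the signed entries of the comparison matrix. That matrix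
-- therefore has to be nonnegative and dominate the absolute values of `B` off the diagonal, without
-- exceeding `B` on it. Diagonal weights keep `A` positive, and the weights Aᵢᵢ^β with 2β + 1 = α
-- are those that give equality on the diagonal; α ≥ 1 enters as β ≥ 0, which makes x^β monotone in
-- x. A matrix with negative entries offers no such comparison: turning an entry -1 of a 4-cycle
-- into 1 can destroy positivity. Squaring the entries removes the signs at the price of halving the
-- exponent, which is the source of the threshold 2. Once φ_α[A] is known to be positive, it is
-- itself a nonnegative comparison matrix for ψ_α[A]. The Schur product theorem is obtained by
-- eliminating one index at a time. Pivots are multiplied through and cancelled at the end, so that
-- a zero pivot is a separate, easy case.

-- The library's ring solver can cancel terms only if equality of coefficients is
-- decided by computation, so it is instantiated with integer coefficients.
module IntegerCoefficients {c ℓ} (R : CommutativeRing c ℓ) where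
  open CommutativeRing R
  open Algebra.Properties.Ring ring using (-‿distribˡ-*; -‿distribʳ-*; -0#≈0#)
  open Algebra.Properties.AbelianGroup +-abelianGroup using (⁻¹-∙-comm; ⁻¹-involutive)
  open Algebra.Properties.Semiring.Mult.TCOptimised semiring
    using (1+×; ×-homo-+; ×1-homo-*) renaming (_×_ to _×ⁿ_)
  open Relation.Binary.Reasoning.Setoid setoid

  ⟦_⟧ᶻ : ℤ → Carrier
  ⟦ + n ⟧ᶻ      = n ×ⁿ 1#
  ⟦ -[1+ n ] ⟧ᶻ = - (suc n ×ⁿ 1#)

  -- Sums of integers of opposite signs compute through `ℤ._⊖_`, so both mixed cases of `+-homo`
  -- reduce to this one.
  ⊖-homo : ∀ m n → ⟦ m ℤ.⊖ n ⟧ᶻ ≈ m ×ⁿ 1# + - (n ×ⁿ 1#)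
  ⊖-homo zero    zero    = sym (-‿inverseʳ 0#)
  ⊖-homo zero    (suc n) = sym (+-identityˡ _)
  ⊖-homo (suc m) zero    = sym (trans (+-congˡ -0#≈0#) (+-identityʳ _))
  ⊖-homo (suc m) (suc n) = begin
    ⟦ suc m ℤ.⊖ suc n ⟧ᶻ                    ≡⟨ ≡.cong ⟦_⟧ᶻ (ℤ.[1+m]⊖[1+n]≡m⊖n m n) ⟩
    ⟦ m ℤ.⊖ n ⟧ᶻ                            ≈⟨ ⊖-homo m n ⟩
    m ×ⁿ 1# + - (n ×ⁿ 1#)                     ≈⟨ +-congʳ (+-identityʳ _) ⟨
    m ×ⁿ 1# + 0# + - (n ×ⁿ 1#)                ≈⟨ +-congʳ (+-congˡ (-‿inverseʳ 1#)) ⟨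
    m ×ⁿ 1# + (1# + - 1#) + - (n ×ⁿ 1#)       ≈⟨ +-congʳ (+-assoc _ _ _) ⟨
    m ×ⁿ 1# + 1# + - 1# + - (n ×ⁿ 1#)         ≈⟨ +-assoc _ _ _ ⟩
    m ×ⁿ 1# + 1# + (- 1# + - (n ×ⁿ 1#))       ≈⟨ +-cong (+-comm _ _) (⁻¹-∙-comm _ _) ⟩
    1# + m ×ⁿ 1# + - (1# + n ×ⁿ 1#)           ≈⟨ +-cong (1+× m 1#) (-‿cong (1+× n 1#)) ⟨
    suc m ×ⁿ 1# + - (suc n ×ⁿ 1#)             ∎

  +-homo : ∀ i j → ⟦ i ℤ.+ j ⟧ᶻ ≈ ⟦ i ⟧ᶻ + ⟦ j ⟧ᶻ
  +-homo (+ m)    (+ n)    = ×-homo-+ 1# m n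
  +-homo (+ m)    -[1+ n ] = ⊖-homo m (suc n)
  +-homo -[1+ m ] (+ n)    = trans (⊖-homo n (suc m)) (+-comm _ _)
  +-homo -[1+ m ] -[1+ n ] = begin
    - (suc (suc (m ℕ.+ n)) ×ⁿ 1#)       ≡⟨ ≡.cong (λ k → - (k ×ⁿ 1#)) (≡.cong suc (ℕ.+-suc m n)) ⟨
    - ((suc m ℕ.+ suc n) ×ⁿ 1#)         ≈⟨ -‿cong (×-homo-+ 1# (suc m) (suc n)) ⟩
    - (suc m ×ⁿ 1# + suc n ×ⁿ 1#)        ≈⟨ ⁻¹-∙-comm _ _ ⟨
    - (suc m ×ⁿ 1#) + - (suc n ×ⁿ 1#)    ∎

  -‿homo : ∀ i → ⟦ ℤ.- i ⟧ᶻ ≈ - ⟦ i ⟧ᶻ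
  -‿homo (+ zero)  = sym -0#≈0#
  -‿homo (+ suc n) = refl
  -‿homo -[1+ n ]  = sym (⁻¹-involutive _)

  *-homo⁺ : ∀ m j → ⟦ + m ℤ.* j ⟧ᶻ ≈ m ×ⁿ 1# * ⟦ j ⟧ᶻ
  *-homo⁺ m (+ n) = begin
    ⟦ + m ℤ.* + n ⟧ᶻ      ≡⟨ ≡.cong ⟦_⟧ᶻ (ℤ.pos-* m n) ⟨
    ⟦ + (m ℕ.* n) ⟧ᶻ      ≈⟨ ×1-homo-* m n ⟩
    m ×ⁿ 1# * (n ×ⁿ 1#)     ∎
  *-homo⁺ m -[1+ n ] = begin
    ⟦ + m ℤ.* (ℤ.- + suc n) ⟧ᶻ    ≡⟨ ≡.cong ⟦_⟧ᶻ (ℤ.neg-distribʳ-* (+ m) (+ suc n)) ⟨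
    ⟦ ℤ.- (+ m ℤ.* + suc n) ⟧ᶻ    ≈⟨ -‿homo (+ m ℤ.* + suc n) ⟩
    - ⟦ + m ℤ.* + suc n ⟧ᶻ        ≈⟨ -‿cong (*-homo⁺ m (+ suc n)) ⟩
    - (m ×ⁿ 1# * (suc n ×ⁿ 1#))     ≈⟨ -‿distribʳ-* _ _ ⟩
    m ×ⁿ 1# * - (suc n ×ⁿ 1#)       ∎

  *-homo : ∀ i j → ⟦ i ℤ.* j ⟧ᶻ ≈ ⟦ i ⟧ᶻ * ⟦ j ⟧ᶻ
  *-homo (+ m)    j = *-homo⁺ m j
  *-homo -[1+ m ] j = begin
    ⟦ (ℤ.- + suc m) ℤ.* j ⟧ᶻ      ≡⟨ ≡.cong ⟦_⟧ᶻ (ℤ.neg-distribˡ-* (+ suc m) j) ⟨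
    ⟦ ℤ.- (+ suc m ℤ.* j) ⟧ᶻ      ≈⟨ -‿homo (+ suc m ℤ.* j) ⟩
    - ⟦ + suc m ℤ.* j ⟧ᶻ          ≈⟨ -‿cong (*-homo⁺ (suc m) j) ⟩
    - (suc m ×ⁿ 1# * ⟦ j ⟧ᶻ)       ≈⟨ -‿distribˡ-* _ _ ⟩
    - (suc m ×ⁿ 1#) * ⟦ j ⟧ᶻ       ∎

  homomorphism : CommutativeRing.rawRing ℤ.+-*-commutativeRing -Raw-AlmostCommutative⟶ fromCommutativeRing R
  homomorphism = record
    { ⟦_⟧    = ⟦_⟧ᶻ
    ; +-homo = +-homo
    ; *-homo = *-homo
    ; -‿homo = -‿homo
    ; 0-homo = refl
    ; 1-homo = refl
    }

  ≟-coefficient : ∀ i j → Maybe (⟦ i ⟧ᶻ ≈ ⟦ j ⟧ᶻ)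
  ≟-coefficient i j = Maybe.map (λ i≡j → reflexive (≡.cong ⟦_⟧ᶻ i≡j)) (dec⇒maybe (i ℤ.≟ j))

  open Algebra.Solver.Ring _ _ homomorphism ≟-coefficient public
    using (solve; _:=_; _:+_; _:*_; _:-_; :-_; con)

-- Ordered fields

module OrderedField (ℝ : CompleteOrderedField) where
  open CompleteOrderedField ℝ
  open IntegerCoefficients commutativeRing
  open IsDecTotalOrder isDecTotalOrder public
    using (antisym; total; isPartialOrder; ≤-respʳ-≈; ≤-respˡ-≈)
    renaming (refl to ≤-refl; reflexive to ≤-reflexive; trans to ≤-trans)

  poset : Poset _ _ _
  poset = record { isPartialOrder = isPartialOrder }

  open Relation.Binary.Reasoning.PartialOrder poset

  +-mono-≤ : ∀ {x y u v} → x ≤ y → u ≤ v → x + u ≤ y + v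
  +-mono-≤ {x} {y} {u} {v} x≤y u≤v = begin
    x + u   ≤⟨ +-monoˡ-≤ u x≤y ⟩
    y + u   ≈⟨ +-comm y u ⟩
    u + y   ≤⟨ +-monoˡ-≤ y u≤v ⟩
    v + y   ≈⟨ +-comm v y ⟩
    y + v   ∎

  +-nonneg : ∀ {x y} → 0# ≤ x → 0# ≤ y → 0# ≤ x + y
  +-nonneg 0≤x 0≤y = ≤-respˡ-≈ (+-identityˡ 0#) (+-mono-≤ 0≤x 0≤y)

  x≤y⇒0≤y-x : ∀ {x y} → x ≤ y → 0# ≤ y - x
  x≤y⇒0≤y-x {x} x≤y = ≤-respˡ-≈ (-‿inverseʳ x) (+-monoˡ-≤ (- x) x≤y)

  0≤y-x⇒x≤y : ∀ {x y} → 0# ≤ y - x → x ≤ y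
  0≤y-x⇒x≤y {x} {y} 0≤y-x = begin
    x             ≈⟨ +-identityˡ x ⟨
    0# + x        ≤⟨ +-monoˡ-≤ x 0≤y-x ⟩
    y - x + x     ≈⟨ solve 2 (λ x y → y :- x :+ x := y) refl x y ⟩
    y             ∎

  x≤0⇒0≤-x : ∀ {x} → x ≤ 0# → 0# ≤ - x
  x≤0⇒0≤-x {x} x≤0 = ≤-respʳ-≈ (+-identityˡ (- x)) (x≤y⇒0≤y-x x≤0)

  *-monoˡ-≤ : ∀ {x y z} → 0# ≤ z → x ≤ y → z * x ≤ z * y
  *-monoˡ-≤ {x} {y} {z} 0≤z x≤y = 0≤y-x⇒x≤y (begin
    0#              ≤⟨ *-nonneg 0≤z (x≤y⇒0≤y-x x≤y) ⟩
    z * (y - x)     ≈⟨ solve 3 (λ x y z → z :* (y :- x) := z :* y :- z :* x) refl x y z ⟩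
    z * y - z * x   ∎)

  x*x-nonneg : ∀ x → 0# ≤ x * x
  x*x-nonneg x with total 0# x
  ... | inj₁ 0≤x = *-nonneg 0≤x 0≤x
  ... | inj₂ x≤0 = ≤-respʳ-≈ (solve 1 (λ x → :- x :* :- x := x :* x) refl x)
                             (*-nonneg (x≤0⇒0≤-x x≤0) (x≤0⇒0≤-x x≤0))

  0≤1 : 0# ≤ 1#
  0≤1 = ≤-respʳ-≈ (*-identityˡ 1#) (x*x-nonneg 1#)

  0<1 : 0# < 1#
  0<1 = 0≤1 , 0≉1

  <⇒≱ : ∀ {x y} → x < y → ¬ y ≤ x
  <⇒≱ (x≤y , x≉y) y≤x = x≉y (antisym x≤y y≤x)

  <-≤-trans : ∀ {x y z} → x < y → y ≤ z → x < z
  <-≤-trans (x≤y , x≉y) y≤z = ≤-trans x≤y y≤z , λ x≈z → x≉y (antisym x≤y (≤-respʳ-≈ (sym x≈z) y≤z))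

  x<x+1 : ∀ x → x < x + 1#
  x<x+1 x = ≤-respˡ-≈ (+-identityʳ x) (+-mono-≤ ≤-refl 0≤1) ,
    λ x≈x+1 → 0≉1 (trans (sym (-‿inverseʳ x)) (trans (+-congʳ x≈x+1) (solve 1 (λ x → x :+ con (+ 1) :- x := con (+ 1)) refl x)))

  x*y≈0⇒y≈0 : ∀ {x y} → ¬ x ≈ 0# → x * y ≈ 0# → y ≈ 0#
  x*y≈0⇒y≈0 {x} {y} x≉0 x*y≈0 with inverse x x≉0
  ... | x⁻¹ , x*x⁻¹≈1 = begin-equality
    y               ≈⟨ *-identityˡ y ⟨
    1# * y          ≈⟨ *-congʳ x*x⁻¹≈1 ⟨
    x * x⁻¹ * y     ≈⟨ solve 3 (λ x z y → x :* z :* y := z :* (x :* y)) refl x x⁻¹ y ⟩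
    x⁻¹ * (x * y)   ≈⟨ *-congˡ x*y≈0 ⟩
    x⁻¹ * 0#        ≈⟨ zeroʳ x⁻¹ ⟩
    0#              ∎

  x*x≤0⇒x≈0 : ∀ {x} → x * x ≤ 0# → x ≈ 0#
  x*x≤0⇒x≈0 {x} x*x≤0 with x ≟ 0#
  ... | yes x≈0 = x≈0
  ... | no  x≉0 = x*y≈0⇒y≈0 x≉0 (antisym x*x≤0 (x*x-nonneg x))

  *-positive : ∀ {x y} → 0# < x → 0# < y → 0# < x * y
  *-positive (0≤x , 0≉x) (0≤y , 0≉y) = *-nonneg 0≤x 0≤y ,
    λ 0≈x*y → 0≉y (sym (x*y≈0⇒y≈0 (λ x≈0 → 0≉x (sym x≈0)) (sym 0≈x*y)))

  inverse-positive : ∀ {x} → 0# < x → ∃[ y ] 0# < y × x * y ≈ 1#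
  inverse-positive {x} (0≤x , 0≉x) with inverse x (λ x≈0 → 0≉x (sym x≈0))
  ... | y , x*y≈1 = y , (0≤y , 0≉y) , x*y≈1
    where
    0≤y : 0# ≤ y
    0≤y = begin
      0#            ≤⟨ *-nonneg (x*x-nonneg y) 0≤x ⟩
      y * y * x     ≈⟨ solve 2 (λ x y → y :* y :* x := x :* y :* y) refl x y ⟩
      x * y * y     ≈⟨ *-congʳ x*y≈1 ⟩
      1# * y        ≈⟨ *-identityˡ y ⟩
      y             ∎
    0≉y : ¬ 0# ≈ y
    0≉y 0≈y = 0≉1 (trans (sym (zeroʳ x)) (trans (*-congˡ 0≈y) x*y≈1))

  -- Stands in for division: later inequalities are proved after multiplication by a positive
  -- factor, such as a pivot, and the factor is removed here.
  *-cancelˡ-nonneg : ∀ {x y} → 0# < x → 0# ≤ x * y → 0# ≤ y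
  *-cancelˡ-nonneg {x} {y} 0<x 0≤x*y with inverse-positive 0<x
  ... | z , (0≤z , _) , x*z≈1 = begin
    0#            ≤⟨ *-nonneg 0≤z 0≤x*y ⟩
    z * (x * y)   ≈⟨ solve 3 (λ x y z → z :* (x :* y) := x :* z :* y) refl x y z ⟩
    x * z * y     ≈⟨ *-congʳ x*z≈1 ⟩
    1# * y        ≈⟨ *-identityˡ y ⟩
    y             ∎

  nonneg∧≉0⇒positive : ∀ {x} → 0# ≤ x → ¬ x ≈ 0# → 0# < x
  nonneg∧≉0⇒positive 0≤x x≉0 = 0≤x , λ 0≈x → x≉0 (sym 0≈x)

  0<2 : 0# < 1# + 1#
  0<2 = <-≤-trans 0<1 (proj₁ (x<x+1 1#))

  0≤x⇒-x≤x : ∀ {x} → 0# ≤ x → - x ≤ x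
  0≤x⇒-x≤x {x} 0≤x = 0≤y-x⇒x≤y (≤-respʳ-≈ (solve 1 (λ x → x :+ x := x :- :- x) refl x) (+-nonneg 0≤x 0≤x))

-- Real powers and their extensions to the real line

module PowerFunctions (ℝ : CompleteOrderedField) (pow : RealPower ℝ) where
  open CompleteOrderedField ℝ
  open RealPower pow
  open Powers ℝ pow
  open OrderedField ℝ
  open Algebra.Properties.Ring ring using (-1*x≈-x; -‿involutive)
  open IntegerCoefficients commutativeRing
  open Relation.Binary.Reasoning.PartialOrder poset

  -- The functional equations of `_^_` determine 1^α and x^0 only as positive idempotents; this
  -- identifies them.
  x*x≈x⇒x≈1 : ∀ {x} → 0# < x → x * x ≈ x → x ≈ 1#
  x*x≈x⇒x≈1 {x} 0<x x*x≈x with inverse-positive 0<x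
  ... | y , _ , x*y≈1 = begin-equality
    x             ≈⟨ *-identityʳ x ⟨
    x * 1#        ≈⟨ *-congˡ x*y≈1 ⟨
    x * (x * y)   ≈⟨ *-assoc x x y ⟨
    x * x * y     ≈⟨ *-congʳ x*x≈x ⟩
    x * y         ≈⟨ x*y≈1 ⟩
    1#            ∎

  1^α≈1 : ∀ α → 1# ^ α ≈ 1#
  1^α≈1 α = x*x≈x⇒x≈1 (^-positive α 0<1)
    (trans (sym (^-distribʳ-* α 0<1 0<1)) (^-cong (*-identityˡ 1#) refl))

  x^0≈1 : ∀ {x} → 0# < x → x ^ 0# ≈ 1#
  x^0≈1 0<x = x*x≈x⇒x≈1 (^-positive 0# 0<x)
    (trans (sym (^-distribˡ-+-* 0# 0# 0<x)) (^-cong refl (+-identityˡ 0#)))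

  -- `^-monoʳ-<` is strict in the exponents and requires a base above 1, so base 1 and exponent 0
  -- are split off.
  1≤x^α : ∀ {x α} → 1# ≤ x → 0# ≤ α → 1# ≤ x ^ α
  1≤x^α {x} {α} 1≤x 0≤α with x ≟ 1# | α ≟ 0#
  ... | yes x≈1 | _       = ≤-reflexive (sym (trans (^-cong x≈1 refl) (1^α≈1 α)))
  ... | no  _   | yes α≈0 = ≤-reflexive (sym (trans (^-cong refl α≈0) (x^0≈1 (<-≤-trans 0<1 1≤x))))
  ... | no  x≉1 | no  α≉0 = ≤-respˡ-≈ (x^0≈1 (<-≤-trans 0<1 1≤x))
    (proj₁ (^-monoʳ-< (1≤x , λ 1≈x → x≉1 (sym 1≈x)) (nonneg∧≉0⇒positive 0≤α α≉0)))

  -- Monotonicity is axiomatic in the exponent only. In the base it follows from y = x · (y / x),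
  -- since y / x ≥ 1 has a power at least 1.
  ^-monoˡ-≤ : ∀ {x y} α → 0# ≤ α → 0# < x → x ≤ y → x ^ α ≤ y ^ α
  ^-monoˡ-≤ {x} {y} α 0≤α 0<x x≤y with inverse-positive 0<x
  ... | z , 0<z , x*z≈1 = begin
    x ^ α                 ≈⟨ *-identityʳ _ ⟨
    x ^ α * 1#            ≤⟨ *-monoˡ-≤ (proj₁ (^-positive α 0<x)) (1≤x^α 1≤z*y 0≤α) ⟩
    x ^ α * (z * y) ^ α   ≈⟨ ^-distribʳ-* α 0<x (*-positive 0<z (<-≤-trans 0<x x≤y)) ⟨
    (x * (z * y)) ^ α     ≈⟨ ^-cong (trans (sym (*-assoc x z y)) (trans (*-congʳ x*z≈1) (*-identityˡ y))) refl ⟩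
    y ^ α                 ∎
    where
    1≤z*y : 1# ≤ z * y
    1≤z*y = ≤-respˡ-≈ (trans (*-comm z x) x*z≈1) (*-monoˡ-≤ (proj₁ 0<z) x≤y)

  ^-double : ∀ {x} α → 0# < x → x ^ (α + α) ≈ (x * x) ^ α
  ^-double α 0<x = trans (^-distribˡ-+-* α α 0<x) (sym (^-distribʳ-* α 0<x 0<x))

  x^2≈x*x : ∀ {x} → 0# < x → x ^ 2# ≈ x * x
  x^2≈x*x 0<x = trans (^-double 1# 0<x) (^-identityʳ (*-positive 0<x 0<x))

  half : ∀ x → ∃[ y ] y + y ≈ x
  half x with inverse-positive 0<2
  ... | h , _ , 2*h≈1 = h * x , trans (solve 2 (λ h x → h :* x :+ h :* x := con (+ 2) :* h :* x) refl h x)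
                                      (trans (*-congʳ 2*h≈1) (*-identityˡ x))

  2*x-nonneg⇒x-nonneg : ∀ {x} → 0# ≤ x + x → 0# ≤ x
  2*x-nonneg⇒x-nonneg {x} 0≤x+x = *-cancelˡ-nonneg 0<2
    (≤-respʳ-≈ (solve 1 (λ x → x :+ x := con (+ 2) :* x) refl x) 0≤x+x)

  x≥0⇒∣x∣≈x : ∀ {x} → 0# ≤ x → ∣ x ∣ ≈ x
  x≥0⇒∣x∣≈x {x} 0≤x with 0# ≤? x
  ... | yes _   = refl
  ... | no  0≰x = contradiction 0≤x 0≰x

  x≤0⇒∣x∣≈-x : ∀ {x} → x ≤ 0# → ∣ x ∣ ≈ - x
  x≤0⇒∣x∣≈-x {x} x≤0 with 0# ≤? x
  ... | yes 0≤x = trans x≈0 (sym (trans (-‿cong x≈0) (solve 0 (:- con (+ 0) := con (+ 0)) refl)))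
    where x≈0 = antisym x≤0 0≤x
  ... | no  _   = refl

  ∣-∣-nonneg : ∀ x → 0# ≤ ∣ x ∣
  ∣-∣-nonneg x with total 0# x
  ... | inj₁ 0≤x = ≤-respʳ-≈ (sym (x≥0⇒∣x∣≈x 0≤x)) 0≤x
  ... | inj₂ x≤0 = ≤-respʳ-≈ (sym (x≤0⇒∣x∣≈-x x≤0)) (x≤0⇒0≤-x x≤0)

  ∣-∣-cong : ∀ {x y} → x ≈ y → ∣ x ∣ ≈ ∣ y ∣
  ∣-∣-cong {x} {y} x≈y with total 0# x
  ... | inj₁ 0≤x = trans (x≥0⇒∣x∣≈x 0≤x) (trans x≈y (sym (x≥0⇒∣x∣≈x (≤-respʳ-≈ x≈y 0≤x))))
  ... | inj₂ x≤0 = trans (x≤0⇒∣x∣≈-x x≤0) (trans (-‿cong x≈y) (sym (x≤0⇒∣x∣≈-x (≤-respˡ-≈ x≈y x≤0))))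

  ∣x∣*∣x∣≈x*x : ∀ x → ∣ x ∣ * ∣ x ∣ ≈ x * x
  ∣x∣*∣x∣≈x*x x with total 0# x
  ... | inj₁ 0≤x = *-cong (x≥0⇒∣x∣≈x 0≤x) (x≥0⇒∣x∣≈x 0≤x)
  ... | inj₂ x≤0 = trans (*-cong (x≤0⇒∣x∣≈-x x≤0) (x≤0⇒∣x∣≈-x x≤0))
                         (solve 1 (λ x → :- x :* :- x := x :* x) refl x)

  x≉0⇒∣x∣>0 : ∀ {x} → ¬ x ≈ 0# → 0# < ∣ x ∣
  x≉0⇒∣x∣>0 {x} x≉0 = ∣-∣-nonneg x , λ 0≈∣x∣ → x≉0 (x*x≤0⇒x≈0 (≤-reflexive
    (trans (sym (∣x∣*∣x∣≈x*x x)) (trans (*-congʳ (sym 0≈∣x∣)) (zeroˡ _)))))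

  sgn-positive : ∀ {x} → 0# < x → sgn x ≈ 1#
  sgn-positive {x} (0≤x , 0≉x) with x ≟ 0# | 0# ≤? x
  ... | yes x≈0 | _       = contradiction (sym x≈0) 0≉x
  ... | no  _   | yes _   = refl
  ... | no  _   | no  0≰x = contradiction 0≤x 0≰x

  sgn≈±1 : ∀ {x} → ¬ x ≈ 0# → sgn x ≈ 1# ⊎ sgn x ≈ - 1#
  sgn≈±1 {x} x≉0 with x ≟ 0# | 0# ≤? x
  ... | yes x≈0 | _     = contradiction x≈0 x≉0
  ... | no  _   | yes _ = inj₁ refl
  ... | no  _   | no  _ = inj₂ refl

  sgn-*-∣-∣ : ∀ x → sgn x * ∣ x ∣ ≈ x
  sgn-*-∣-∣ x with x ≟ 0# | 0# ≤? x
  ... | yes x≈0 | _     = trans (zeroˡ _) (sym x≈0)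
  ... | no  _   | yes _ = *-identityˡ x
  ... | no  _   | no  _ = solve 1 (λ x → :- con (+ 1) :* :- x := x) refl x

  sgn-cong : ∀ {x y} → x ≈ y → sgn x ≈ sgn y
  sgn-cong {x} {y} x≈y with x ≟ 0# | y ≟ 0#
  ... | yes _   | yes _   = refl
  ... | yes x≈0 | no  y≉0 = contradiction (trans (sym x≈y) x≈0) y≉0
  ... | no  x≉0 | yes y≈0 = contradiction (trans x≈y y≈0) x≉0
  ... | no  _   | no  _ with 0# ≤? x | 0# ≤? y
  ...   | yes _   | yes _   = refl
  ...   | yes 0≤x | no  0≰y = contradiction (≤-respʳ-≈ x≈y 0≤x) 0≰y
  ...   | no  0≰x | yes 0≤y = contradiction (≤-respʳ-≈ (sym x≈y) 0≤y) 0≰x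
  ...   | no  _   | no  _   = refl

  -- `power α`, `φ α` and `ψ α` differ only at negative arguments. Whatever uses only their common
  -- values on [0,∞) is proved once from this interface.
  record IsPower (α : Carrier) (f : Carrier → Carrier) : Set where
    field
      cong   : ∀ {x y} → x ≈ y → f x ≈ f y
      at-0   : f 0# ≈ 0#
      at-pos : ∀ {x} → 0# < x → f x ≈ x ^ α

    zero-cong : ∀ {x} → x ≈ 0# → f x ≈ 0#
    zero-cong x≈0 = trans (cong x≈0) at-0

    at-1 : f 1# ≈ 1#
    at-1 = trans (at-pos 0<1) (1^α≈1 α)

    nonneg : ∀ {x} → 0# ≤ x → 0# ≤ f x
    nonneg {x} 0≤x with x ≟ 0#
    ... | yes x≈0 = ≤-reflexive (sym (zero-cong x≈0))
    ... | no  x≉0 = ≤-respʳ-≈ (sym (at-pos 0<x)) (proj₁ (^-positive α 0<x))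
      where 0<x = nonneg∧≉0⇒positive 0≤x x≉0

  private
    extend-by-0-cong : ∀ {g : Carrier → Carrier} → (∀ {x y} → x ≈ y → g x ≈ g y) → ∀ {x y} → x ≈ y →
      (if does (x ≟ 0#) then 0# else g x) ≈ (if does (y ≟ 0#) then 0# else g y)
    extend-by-0-cong g-cong {x} {y} x≈y with x ≟ 0# | y ≟ 0#
    ... | yes _   | yes _   = refl
    ... | yes x≈0 | no  y≉0 = contradiction (trans (sym x≈y) x≈0) y≉0
    ... | no  x≉0 | yes y≈0 = contradiction (trans x≈y y≈0) x≉0
    ... | no  _   | no  _   = g-cong x≈y

    extend-by-0-at-0 : ∀ {y : Carrier} → (if does (0# ≟ 0#) then 0# else y) ≈ 0#
    extend-by-0-at-0 with 0# ≟ 0#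
    ... | yes _   = refl
    ... | no  0≉0 = contradiction refl 0≉0

    extend-by-0-at-≉0 : ∀ {x y} → ¬ x ≈ 0# → (if does (x ≟ 0#) then 0# else y) ≈ y
    extend-by-0-at-≉0 {x} x≉0 with x ≟ 0#
    ... | yes x≈0 = contradiction x≈0 x≉0
    ... | no  _   = refl

  φ-at-≉0 : ∀ α {x} → ¬ x ≈ 0# → φ α x ≈ ∣ x ∣ ^ α
  φ-at-≉0 α = extend-by-0-at-≉0

  ψ-at-≉0 : ∀ α {x} → ¬ x ≈ 0# → ψ α x ≈ sgn x * ∣ x ∣ ^ α
  ψ-at-≉0 α = extend-by-0-at-≉0

  power-isPower : ∀ α → IsPower α (power α)
  power-isPower α = record
    { cong   = extend-by-0-cong (λ x≈y → ^-cong x≈y refl)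
    ; at-0   = extend-by-0-at-0
    ; at-pos = λ 0<x → extend-by-0-at-≉0 (λ x≈0 → proj₂ 0<x (sym x≈0))
    }

  φ-isPower : ∀ α → IsPower α (φ α)
  φ-isPower α = record
    { cong   = extend-by-0-cong (λ x≈y → ^-cong (∣-∣-cong x≈y) refl)
    ; at-0   = extend-by-0-at-0
    ; at-pos = λ 0<x → trans (extend-by-0-at-≉0 (λ x≈0 → proj₂ 0<x (sym x≈0)))
                             (^-cong (x≥0⇒∣x∣≈x (proj₁ 0<x)) refl)
    }

  ψ-isPower : ∀ α → IsPower α (ψ α)
  ψ-isPower α = record
    { cong   = extend-by-0-cong (λ x≈y → *-cong (sgn-cong x≈y) (^-cong (∣-∣-cong x≈y) refl))
    ; at-0   = extend-by-0-at-0
    ; at-pos = λ 0<x → trans (ψ-at-≉0 α (λ x≈0 → proj₂ 0<x (sym x≈0)))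
                      (trans (*-cong (sgn-positive 0<x) (^-cong (x≥0⇒∣x∣≈x (proj₁ 0<x)) refl))
                             (*-identityˡ _))
    }

  φ-double : ∀ {α β} → β + β ≈ α → ∀ x → power β (x * x) ≈ φ α x
  φ-double {α} {β} β+β≈α x = case x ≟ 0# of λ where
      (yes x≈0) → trans (^β.zero-cong (trans (*-congʳ x≈0) (zeroˡ x))) (sym (IsPower.zero-cong (φ-isPower α) x≈0))
      (no  x≉0) → let 0<∣x∣ = x≉0⇒∣x∣>0 x≉0 in begin-equality
        power β (x * x)         ≈⟨ ^β.cong (∣x∣*∣x∣≈x*x x) ⟨
        power β (∣ x ∣ * ∣ x ∣) ≈⟨ ^β.at-pos (*-positive 0<∣x∣ 0<∣x∣) ⟩
        (∣ x ∣ * ∣ x ∣) ^ β     ≈⟨ ^-double β 0<∣x∣ ⟨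
        ∣ x ∣ ^ (β + β)         ≈⟨ ^-cong refl β+β≈α ⟩
        ∣ x ∣ ^ α               ≈⟨ φ-at-≉0 α x≉0 ⟨
        φ α x                   ∎
    where module ^β = IsPower (power-isPower β)

  φ-nonneg : ∀ α x → 0# ≤ φ α x
  φ-nonneg α x = case x ≟ 0# of λ where
    (yes x≈0) → ≤-reflexive (sym (IsPower.zero-cong (φ-isPower α) x≈0))
    (no  x≉0) → ≤-respʳ-≈ (sym (φ-at-≉0 α x≉0)) (proj₁ (^-positive α (x≉0⇒∣x∣>0 x≉0)))

  φ≈ψ : ∀ α {x} → 0# ≤ x → φ α x ≈ ψ α x
  φ≈ψ α {x} 0≤x = case x ≟ 0# of λ where
    (yes x≈0) → trans (IsPower.zero-cong (φ-isPower α) x≈0) (sym (IsPower.zero-cong (ψ-isPower α) x≈0))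
    (no  x≉0) → let 0<x = nonneg∧≉0⇒positive 0≤x x≉0 in
      trans (IsPower.at-pos (φ-isPower α) 0<x) (sym (IsPower.at-pos (ψ-isPower α) 0<x))

  ψ≈±φ : ∀ α x → ψ α x ≈ φ α x ⊎ ψ α x ≈ - φ α x
  ψ≈±φ α x = case x ≟ 0# of λ where
    (yes x≈0) → inj₁ (trans (IsPower.zero-cong (ψ-isPower α) x≈0) (sym (IsPower.zero-cong (φ-isPower α) x≈0)))
    (no  x≉0) → Sum.map
      (λ sgn≈1  → trans (ψ-at-≉0 α x≉0) (trans (*-congʳ sgn≈1)  (trans (*-identityˡ _) (sym (φ-at-≉0 α x≉0)))))
      (λ sgn≈-1 → trans (ψ-at-≉0 α x≉0) (trans (*-congʳ sgn≈-1) (trans (-1*x≈-x _) (-‿cong (sym (φ-at-≉0 α x≉0))))))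
      (sgn≈±1 x≉0)

  ψ≤φ : ∀ α x → ψ α x ≤ φ α x
  ψ≤φ α x with ψ≈±φ α x
  ... | inj₁ ψ≈φ  = ≤-reflexive ψ≈φ
  ... | inj₂ ψ≈-φ = ≤-respˡ-≈ (sym ψ≈-φ) (0≤x⇒-x≤x (φ-nonneg α x))

  -ψ≤φ : ∀ α x → - ψ α x ≤ φ α x
  -ψ≤φ α x with ψ≈±φ α x
  ... | inj₁ ψ≈φ  = ≤-respˡ-≈ (-‿cong (sym ψ≈φ)) (0≤x⇒-x≤x (φ-nonneg α x))
  ... | inj₂ ψ≈-φ = ≤-reflexive (trans (-‿cong ψ≈-φ) (-‿involutive _))

  ψ-1 : ∀ {α} → α ≈ 1# → ∀ x → ψ α x ≈ x
  ψ-1 {α} α≈1 x = case x ≟ 0# of λ where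
    (yes x≈0) → trans (IsPower.zero-cong (ψ-isPower α) x≈0) (sym x≈0)
    (no  x≉0) → trans (ψ-at-≉0 α x≉0) (trans
      (*-congˡ (trans (^-cong refl α≈1) (^-identityʳ (x≉0⇒∣x∣>0 x≉0)))) (sgn-*-∣-∣ x))

-- Positive semidefinite matrices

module PositiveSemidefinite (ℝ : CompleteOrderedField) (pow : RealPower ℝ) where
  open CompleteOrderedField ℝ hiding (zero)
  open Powers ℝ pow
  open OrderedField ℝ
  open IntegerCoefficients commutativeRing
  open Algebra.Properties.Semiring.Sum semiring
    using (sum; sum-cong-≋; sum-remove; ∑-distrib-+; ∑-comm; *-distribˡ-sum; *-distribʳ-sum)
  open Relation.Binary.Reasoning.PartialOrder poset

  sum-mono-≤ : ∀ {n} {f g : Fin n → Carrier} → (∀ i → f i ≤ g i) → sum f ≤ sum g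
  sum-mono-≤ {zero}  f≤g = ≤-refl
  sum-mono-≤ {suc n} f≤g = +-mono-≤ (f≤g zero) (sum-mono-≤ (f≤g ∘ suc))

  sum-zero : ∀ {n} {f : Fin n → Carrier} → (∀ i → f i ≈ 0#) → sum f ≈ 0#
  sum-zero {zero}  f≈0 = refl
  sum-zero {suc n} f≈0 = trans (+-cong (f≈0 zero) (sum-zero (f≈0 ∘ suc))) (+-identityˡ 0#)

  sum-single : ∀ {n} (f : Fin n → Carrier) i → (∀ j → i ≢ j → f j ≈ 0#) → sum f ≈ f i
  sum-single {suc n} f i f≈0 = begin-equality
    sum f                           ≈⟨ sum-remove {i = i} f ⟩
    f i + sum (f ∘ punchIn i)       ≈⟨ +-congˡ (sum-zero (λ j → f≈0 _ (λ i≡ → punchInᵢ≢i i j (≡.sym i≡)))) ⟩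
    f i + 0#                        ≈⟨ +-identityʳ (f i) ⟩
    f i                             ∎

  sum₂ : ∀ {m n} → (Fin m → Fin n → Carrier) → Carrier
  sum₂ F = sum (λ i → sum (F i))

  sum₂-cong : ∀ {m n} {F G : Fin m → Fin n → Carrier} → (∀ i j → F i j ≈ G i j) → sum₂ F ≈ sum₂ G
  sum₂-cong F≈G = sum-cong-≋ (λ i → sum-cong-≋ (F≈G i))

  sum₂-mono-≤ : ∀ {m n} {F G : Fin m → Fin n → Carrier} → (∀ i j → F i j ≤ G i j) → sum₂ F ≤ sum₂ G
  sum₂-mono-≤ F≤G = sum-mono-≤ (λ i → sum-mono-≤ (F≤G i))

  sum₂-distrib-+ : ∀ {m n} (F G : Fin m → Fin n → Carrier) →
                   sum₂ (λ i j → F i j + G i j) ≈ sum₂ F + sum₂ G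
  sum₂-distrib-+ F G = trans (sum-cong-≋ (λ i → ∑-distrib-+ (F i) (G i))) (∑-distrib-+ (sum ∘ F) (sum ∘ G))

  *-distribˡ-sum₂ : ∀ {m n} c (F : Fin m → Fin n → Carrier) → c * sum₂ F ≈ sum₂ (λ i j → c * F i j)
  *-distribˡ-sum₂ c F = trans (*-distribˡ-sum c (sum ∘ F)) (sum-cong-≋ (λ i → *-distribˡ-sum c (F i)))

  *-distribʳ-sum₂ : ∀ {m n} c (F : Fin m → Fin n → Carrier) → sum₂ F * c ≈ sum₂ (λ i j → F i j * c)
  *-distribʳ-sum₂ c F = trans (*-distribʳ-sum c (sum ∘ F)) (sum-cong-≋ (λ i → *-distribʳ-sum c (F i)))

  sum-*-sum : ∀ {m n} (f : Fin m → Carrier) c (g : Fin n → Carrier) →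
              sum f * c * sum g ≈ sum₂ (λ i j → f i * c * g j)
  sum-*-sum f c g = begin-equality
    sum f * c * sum g                   ≈⟨ *-congʳ (*-distribʳ-sum c f) ⟩
    sum (λ i → f i * c) * sum g         ≈⟨ *-distribʳ-sum (sum g) (λ i → f i * c) ⟩
    sum (λ i → f i * c * sum g)         ≈⟨ sum-cong-≋ (λ i → *-distribˡ-sum (f i * c) g) ⟩
    sum₂ (λ i j → f i * c * g j)        ∎

  sum₂-comm : ∀ {m n} (F : Fin m → Fin m → Fin n → Fin n → Carrier) →
              sum₂ (λ p q → sum₂ (F p q)) ≈ sum₂ (λ a b → sum₂ (λ p q → F p q a b))
  sum₂-comm F = begin-equality
    sum (λ p → sum (λ q → sum (λ a → sum (F p q a))))
      ≈⟨ sum-cong-≋ (λ p → ∑-comm (λ q a → sum (F p q a))) ⟩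
    sum (λ p → sum (λ a → sum (λ q → sum (F p q a))))
      ≈⟨ ∑-comm (λ p a → sum (λ q → sum (F p q a))) ⟩
    sum (λ a → sum (λ p → sum (λ q → sum (F p q a))))
      ≈⟨ sum₂-cong (λ a p → ∑-comm (λ q b → F p q a b)) ⟩
    sum (λ a → sum (λ p → sum (λ b → sum (λ q → F p q a b))))
      ≈⟨ sum-cong-≋ (λ a → ∑-comm (λ p b → sum (λ q → F p q a b))) ⟩
    sum (λ a → sum (λ b → sum (λ p → sum (λ q → F p q a b))))
      ∎

  sum₂-single : ∀ {m n} (F : Fin m → Fin n → Carrier) i j →
                (∀ k l → i ≢ k → F k l ≈ 0#) → (∀ k l → j ≢ l → F k l ≈ 0#) → sum₂ F ≈ F i j
  sum₂-single F i j row col = trans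
    (sum-single (sum ∘ F) i (λ k i≢k → sum-zero (λ l → row k l i≢k)))
    (sum-single (F i) j (col i))

  PSD-resp-≈ : ∀ {n} {A B : Matrix n} → (∀ i j → A i j ≈ B i j) → PSD A → PSD B
  PSD-resp-≈ A≈B psd = record
    { symmetric = λ i j → trans (sym (A≈B i j)) (trans (symmetric i j) (A≈B j i))
    ; nonneg    = λ x → ≤-respʳ-≈ (sum₂-cong (λ i j → *-congʳ (*-congˡ (A≈B i j)))) (nonneg x)
    }
    where open PSD psd

  infix 10 _ᵀ⟨_⟩_
  -- The matrix product SᵀAT. Allowing rectangular factors lets one congruence lemma cover principal
  -- submatrices, extension by zero, and the restriction of a form to two vectors.
  _ᵀ⟨_⟩_ : ∀ {m n} → (Fin m → Fin n → Carrier) → Matrix m → (Fin m → Fin n → Carrier) → Matrix n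
  (S ᵀ⟨ A ⟩ T) p q = sum₂ (λ i j → S i p * A i j * T j q)

  -- The form of TᵀAT at x is the form of A at Tx.
  PSD-congruence : ∀ {m n} {A : Matrix m} (T : Fin m → Fin n → Carrier) → PSD A → PSD (T ᵀ⟨ A ⟩ T)
  PSD-congruence {A = A} T psd = record
    { symmetric = λ p q → trans (∑-comm (λ i j → T i p * A i j * T j q)) (sum₂-cong (λ i j →
        trans (*-congʳ (*-congˡ (symmetric j i)))
              (solve 3 (λ s a t → s :* a :* t := t :* a :* s) refl (T j p) (A i j) (T i q))))
    ; nonneg    = λ x → ≤-respʳ-≈ (quadratic x) (nonneg (λ i → sum (λ p → T i p * x p)))
    }
    where
    open PSD psd
    quadratic : ∀ x → sum₂ (λ i j → sum (λ p → T i p * x p) * A i j * sum (λ q → T j q * x q)) ≈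
                      sum₂ (λ p q → x p * (T ᵀ⟨ A ⟩ T) p q * x q)
    quadratic x = begin-equality
      sum₂ (λ i j → sum (λ p → T i p * x p) * A i j * sum (λ q → T j q * x q))
        ≈⟨ sum₂-cong (λ i j → sum-*-sum (λ p → T i p * x p) (A i j) (λ q → T j q * x q)) ⟩
      sum₂ (λ i j → sum₂ (λ p q → T i p * x p * A i j * (T j q * x q)))
        ≈⟨ sum₂-comm (λ i j p q → T i p * x p * A i j * (T j q * x q)) ⟩
      sum₂ (λ p q → sum₂ (λ i j → T i p * x p * A i j * (T j q * x q)))
        ≈⟨ sum₂-cong (λ p q → sum₂-cong (λ i j →
             solve 5 (λ s x a t y → s :* x :* a :* (t :* y) := x :* (s :* a :* t) :* y) refl
               (T i p) (x p) (A i j) (T j q) (x q))) ⟩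
      sum₂ (λ p q → sum₂ (λ i j → x p * (T i p * A i j * T j q) * x q))
        ≈⟨ sum₂-cong (λ p q → trans
             (*-congʳ (*-distribˡ-sum₂ (x p) (λ i j → T i p * A i j * T j q)))
             (*-distribʳ-sum₂ (x q) (λ i j → x p * (T i p * A i j * T j q)))) ⟨
      sum₂ (λ p q → x p * (T ᵀ⟨ A ⟩ T) p q * x q)
        ∎

  -- Principal submatrices and 2 × 2 minors

  δ : ∀ {n} → Fin n → Fin n → Carrier
  δ i j with i ≟ᶠ j
  ... | yes _ = 1#
  ... | no  _ = 0#

  δ-≡ : ∀ {n} {i j : Fin n} → i ≡ j → δ i j ≈ 1#
  δ-≡ {i = i} {j} i≡j with i ≟ᶠ j
  ... | yes _   = refl
  ... | no  i≢j = contradiction i≡j i≢j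

  δ-≢ : ∀ {n} {i j : Fin n} → i ≢ j → δ i j ≈ 0#
  δ-≢ {i = i} {j} i≢j with i ≟ᶠ j
  ... | yes i≡j = contradiction i≡j i≢j
  ... | no  _   = refl

  δ-*-zeroˡ : ∀ {n} {i j : Fin n} x y → i ≢ j → δ i j * x * y ≈ 0#
  δ-*-zeroˡ x y i≢j = trans (*-congʳ (trans (*-congʳ (δ-≢ i≢j)) (zeroˡ x))) (zeroˡ y)

  δ-*-zeroʳ : ∀ {n} {i j : Fin n} x y → i ≢ j → x * y * δ i j ≈ 0#
  δ-*-zeroʳ x y i≢j = trans (*-congˡ (δ-≢ i≢j)) (zeroʳ (x * y))

  δ-*-δ : ∀ {m n} {i j : Fin m} {k l : Fin n} x → i ≡ j → k ≡ l → δ i j * x * δ k l ≈ x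
  δ-*-δ x i≡j k≡l = trans (*-cong (trans (*-congʳ (δ-≡ i≡j)) (*-identityˡ x)) (δ-≡ k≡l)) (*-identityʳ x)

  -- Congruence by the 0-1 matrix of `v`. Since `v` may repeat indices, `PSD-minor` can be stated
  -- for all pairs, including i = j.
  PSD-pullback : ∀ {m n} {A : Matrix n} (v : Fin m → Fin n) → PSD A → PSD (λ i j → A (v i) (v j))
  PSD-pullback {A = A} v psd = PSD-resp-≈
    (λ p q → trans
      (sum₂-single (λ i j → δ (v p) i * A i j * δ (v q) j) (v p) (v q)
        (λ k l → δ-*-zeroˡ (A k l) (δ (v q) l)) (λ k l → δ-*-zeroʳ (δ (v p) k) (A k l)))
      (δ-*-δ {i = v p} {k = v q} (A (v p) (v q)) ≡.refl ≡.refl))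
    (PSD-congruence (λ i p → δ (v p) i) psd)

  PSD-diagonal : ∀ {n} {A : Matrix n} → PSD A → ∀ i → 0# ≤ A i i
  PSD-diagonal {A = A} psd i = ≤-respʳ-≈
    (solve 1 (λ a → con (+ 1) :* a :* con (+ 1) :+ con (+ 0) :+ con (+ 0) := a) refl (A i i))
    (PSD.nonneg (PSD-pullback {m = 1} (λ _ → i) psd) (λ _ → 1#))

  PSD-minor₂ : {A : Matrix 2} → PSD A → A 0F 1F * A 0F 1F ≤ A 0F 0F * A 1F 1F
  PSD-minor₂ {A} psd = 0≤y-x⇒x≤y (minor (a ≟ 0#))
    where
    open PSD psd
    a = A 0F 0F
    b = A 0F 1F
    d = A 1F 1F
    form : ∀ s t → 0# ≤ a * s * s + (1# + 1#) * b * s * t + d * t * t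
    form s t = ≤-respʳ-≈
      (trans (+-congˡ (+-congʳ (+-congʳ (*-congʳ (*-congˡ (symmetric 1F 0F))))))
        (solve 5 (λ a b d s t → s :* a :* s :+ (s :* b :* t :+ con (+ 0)) :+
                                ((t :* b :* s :+ (t :* d :* t :+ con (+ 0))) :+ con (+ 0)) :=
                                a :* s :* s :+ con (+ 2) :* b :* s :* t :+ d :* t :* t) refl a b d s t))
      (nonneg λ { 0F → s ; 1F → t })
    minor : _ → 0# ≤ a * d - b * b
    -- The vector (-b, a) is orthogonal to the first basis vector with respect to the form, so its
    -- value is a times the determinant.
    minor (no a≉0) = *-cancelˡ-nonneg (nonneg∧≉0⇒positive (PSD-diagonal psd 0F) a≉0)
      (≤-respʳ-≈ (solve 3 (λ a b d → a :* :- b :* :- b :+ con (+ 2) :* b :* :- b :* a :+ d :* a :* a :=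
                                     a :* (a :* d :- b :* b)) refl a b d)
                 (form (- b) a))
    -- At (− (d + 1) , b) the form takes the value − (d + 2) b² when a ≈ 0.
    minor (yes a≈0) = *-cancelˡ-nonneg (<-≤-trans 0<2 (≤-respˡ-≈ (+-identityˡ _) (+-monoˡ-≤ 2# (PSD-diagonal psd 1F))))
      (≤-respʳ-≈ (begin-equality
          a * - (d + 1#) * - (d + 1#) + (1# + 1#) * b * - (d + 1#) * b + d * b * b
            ≈⟨ +-congʳ (+-congʳ (*-congʳ (*-congʳ a≈0))) ⟩
          0# * - (d + 1#) * - (d + 1#) + (1# + 1#) * b * - (d + 1#) * b + d * b * b
            ≈⟨ solve 2 (λ b d → con (+ 0) :* :- (d :+ con (+ 1)) :* :- (d :+ con (+ 1))
                  :+ con (+ 2) :* b :* :- (d :+ con (+ 1)) :* b :+ d :* b :* b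
                  := (d :+ con (+ 2)) :* (con (+ 0) :* d :- b :* b)) refl b d ⟩
          (d + 2#) * (0# * d - b * b)
            ≈⟨ *-congˡ (+-congʳ (*-congʳ a≈0)) ⟨
          (d + 2#) * (a * d - b * b) ∎)
        (form (- (d + 1#)) b))

  PSD-minor : ∀ {n} {A : Matrix n} → PSD A → ∀ i j → A i j * A i j ≤ A i i * A j j
  PSD-minor psd i j = PSD-minor₂ (PSD-pullback (λ { 0F → i ; 1F → j }) psd)

  PSD-zero-row : ∀ {n} {A : Matrix n} → PSD A → ∀ {i} → A i i ≈ 0# → ∀ j → A i j ≈ 0#
  PSD-zero-row psd {i} Aᵢᵢ≈0 j = x*x≤0⇒x≈0
    (≤-respʳ-≈ (trans (*-congʳ Aᵢᵢ≈0) (zeroˡ _)) (PSD-minor psd i j))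

-- Graphs

-- The only use made of connectedness: a vertex set containing the start of a path but not its end
-- is left by some edge of that path.
Star-crossing : ∀ {a r p} {A : Set a} {R : Rel A r} {P : Pred A p} → Unary.Decidable P →
                ∀ {x y} → Star R x y → P x → ¬ P y → ∃₂ λ u v → P u × R u v × ¬ P v
Star-crossing P? ε Px ¬Py = contradiction Px ¬Py
Star-crossing P? (_◅_ {j = z} Rxz z⟶y) Px ¬Py with P? z
... | yes Pz = Star-crossing P? z⟶y Pz ¬Py
... | no ¬Pz = _ , z , Px , Rxz , ¬Pz

K₁₂⊑ : ∀ {n} {G : Graph n} {b a c} → Adj G b a → Adj G b c → a ≢ c → K 1 2 ⊑ G
K₁₂⊑ {n} {G} {b} {a} {c} b∼a b∼c a≢c = v , injective , adjacent
  where
  v : Fin 3 → Fin n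
  v 0F = b
  v 1F = a
  v 2F = c
  b≢a : b ≢ a
  b≢a b≡a = Graph.irrefl G b≡a b∼a
  b≢c : b ≢ c
  b≢c b≡c = Graph.irrefl G b≡c b∼c
  injective : Injective _≡_ _≡_ v
  injective {0F} {0F} _  = ≡.refl
  injective {0F} {1F} eq = contradiction eq b≢a
  injective {0F} {2F} eq = contradiction eq b≢c
  injective {1F} {0F} eq = contradiction (≡.sym eq) b≢a
  injective {1F} {1F} _  = ≡.refl
  injective {1F} {2F} eq = contradiction eq a≢c
  injective {2F} {0F} eq = contradiction (≡.sym eq) b≢c
  injective {2F} {1F} eq = contradiction (≡.sym eq) a≢c
  injective {2F} {2F} _  = ≡.refl
  cross : ∀ {i j} → Cross 1 2 i j → Adj G (v i) (v j)
  cross {0F}    {1F} _ = b∼a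
  cross {0F}    {2F} _ = b∼c
  cross {suc _}      (s≤s () , _)
  adjacent : ∀ {i j} → Adj (K 1 2) i j → Adj G (v i) (v j)
  adjacent (inj₁ i×j) = cross i×j
  adjacent (inj₂ j×i) = Graph.sym G (cross j×i)

-- An edge leaving the set of vertex 0 alone gives a neighbour a of 0. An edge leaving the pair 0, a
-- then starts at one of the two, and that vertex becomes the centre of the star.
connected⇒K₁₂⊑ : ∀ {n} {G : Graph n} → 3 ℕ.≤ n → Connected G → K 1 2 ⊑ G
connected⇒K₁₂⊑ {suc (suc (suc n))} {G} (s≤s (s≤s (s≤s _))) connected = first-edge (Star-crossing (_≟ᶠ 0F) (connected 0F 1F) ≡.refl λ ())
  where
  -- A third vertex outside the pair 0, a; this is where having at least 3 vertices is used.
  avoiding : ∀ (a : Fin (3 ℕ.+ n)) → ∃ λ c → ¬ (c ≡ 0F ⊎ c ≡ a)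
  avoiding a with a ≟ᶠ 1F
  ... | yes ≡.refl = 2F , λ { (inj₁ ()) ; (inj₂ ()) }
  ... | no  a≢1    = 1F , λ { (inj₁ ()) ; (inj₂ 1≡a) → a≢1 (≡.sym 1≡a) }

  first-edge : (∃₂ λ u a → u ≡ 0F × Adj G u a × a ≢ 0F) → K 1 2 ⊑ G
  first-edge (_ , a , ≡.refl , 0∼a , a≢0) with avoiding a
  ... | c , c∉ with Star-crossing (λ i → (i ≟ᶠ 0F) ⊎-dec (i ≟ᶠ a)) (connected 0F c) (inj₁ ≡.refl) c∉
  ...   | _ , d , inj₁ ≡.refl , 0∼d , d∉ = K₁₂⊑ {G = G} 0∼a 0∼d λ a≡d → d∉ (inj₂ (≡.sym a≡d))
  ...   | _ , d , inj₂ ≡.refl , a∼d , d∉ = K₁₂⊑ {G = G} (Graph.sym G 0∼a) a∼d λ 0≡d → d∉ (inj₁ (≡.sym 0≡d))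

-- Entrywise powers and the Schur product theorem

module EntrywisePowers (ℝ : CompleteOrderedField) (pow : RealPower ℝ) where
  open CompleteOrderedField ℝ hiding (zero)
  open RealPower pow
  open Powers ℝ pow
  open OrderedField ℝ
  open PowerFunctions ℝ pow
  open PositiveSemidefinite ℝ pow
  open IntegerCoefficients commutativeRing
  open Algebra.Properties.Semiring.Sum semiring
    using (sum; sum-cong-≋; ∑-distrib-+)
  open Algebra.Properties.Ring ring using (-1*x≈-x; -‿involutive)
  open Relation.Binary.Reasoning.PartialOrder poset

  -- `A k k` times the Schur complement of the entry (k, k), kept at full size with row and column k
  -- equal to zero. The scaling keeps it meaningful when the pivot vanishes.
  complement : ∀ {n} → Matrix n → Fin n → Matrix n
  complement A k i j = A k k * A i j - A i k * A k j

  -- The form at x equals `A k k * Q x - L x * L x`, the Gram determinant of eₖ and x for the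
  -- semi-inner product of A, so its sign is the Cauchy-Schwarz inequality.
  PSD-complement : ∀ {n} {A : Matrix n} → PSD A → ∀ k → PSD (complement A k)
  PSD-complement {n} {A} psd k = record
    { symmetric = λ i j → +-cong (*-congˡ (symmetric i j))
        (-‿cong (trans (*-cong (symmetric i k) (symmetric k j)) (*-comm _ _)))
    ; nonneg    = λ x → ≤-respʳ-≈ (sym (quadratic x)) (x≤y⇒0≤y-x (cauchy-schwarz x))
    }
    where
    open PSD psd
    Q : (Fin n → Carrier) → Carrier
    Q x = sum₂ (λ i j → x i * A i j * x j)
    L : (Fin n → Carrier) → Carrier
    L x = sum (λ j → A k j * x j)

    quadratic : ∀ x → sum₂ (λ i j → x i * complement A k i j * x j) ≈ A k k * Q x - L x * L x
    quadratic x = begin-equality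
      sum₂ (λ i j → x i * complement A k i j * x j)
        ≈⟨ sum₂-cong (λ i j → trans
             (*-congʳ (*-congˡ (+-congˡ (-‿cong (*-congʳ (symmetric i k))))))
             (solve 6 (λ x a b c d y → x :* (a :* b :- c :* d) :* y :=
                                       a :* (x :* b :* y) :+ c :* x :* :- con (+ 1) :* (d :* y)) refl
                 (x i) (A k k) (A i j) (A k i) (A k j) (x j))) ⟩
      sum₂ (λ i j → A k k * (x i * A i j * x j) + A k i * x i * - 1# * (A k j * x j))
        ≈⟨ sum₂-distrib-+ (λ i j → A k k * (x i * A i j * x j)) (λ i j → A k i * x i * - 1# * (A k j * x j)) ⟩
      sum₂ (λ i j → A k k * (x i * A i j * x j)) + sum₂ (λ i j → A k i * x i * - 1# * (A k j * x j))
        ≈⟨ +-cong (*-distribˡ-sum₂ (A k k) (λ i j → x i * A i j * x j))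
                  (sum-*-sum (λ i → A k i * x i) (- 1#) (λ j → A k j * x j)) ⟨
      A k k * Q x + L x * - 1# * L x
        ≈⟨ solve 2 (λ q l → q :+ l :* :- con (+ 1) :* l := q :- l :* l) refl (A k k * Q x) (L x) ⟩
      A k k * Q x - L x * L x
        ∎

    -- The minor of the restriction of A to the vectors eₖ and x.
    cauchy-schwarz : ∀ x → L x * L x ≤ A k k * Q x
    cauchy-schwarz x = begin
      L x * L x                         ≈⟨ *-cong row row ⟨
      M 0F 1F * M 0F 1F                 ≤⟨ PSD-minor₂ (PSD-congruence T psd) ⟩
      M 0F 0F * M 1F 1F                 ≈⟨ *-congʳ corner ⟩
      A k k * Q x                       ∎
      where
      T : Fin n → Fin 2 → Carrier
      T i 0F = δ k i
      T i 1F = x i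
      M = T ᵀ⟨ A ⟩ T
      δₖₖ*x≈x : ∀ j → δ k k * A k j * x j ≈ A k j * x j
      δₖₖ*x≈x j = *-congʳ (trans (*-congʳ (δ-≡ {i = k} ≡.refl)) (*-identityˡ _))
      row : M 0F 1F ≈ L x
      row = begin-equality
        sum₂ (λ i j → δ k i * A i j * x j)
          ≈⟨ sum-single (λ i → sum (λ j → δ k i * A i j * x j)) k
               (λ i k≢i → sum-zero (λ j → δ-*-zeroˡ (A i j) (x j) k≢i)) ⟩
        sum (λ j → δ k k * A k j * x j)
          ≈⟨ sum-cong-≋ {n = n} δₖₖ*x≈x ⟩
        L x
          ∎
      corner : M 0F 0F ≈ A k k
      corner = trans
        (sum₂-single (λ i j → δ k i * A i j * δ k j) k k
          (λ i j → δ-*-zeroˡ (A i j) (δ k j)) (λ i j → δ-*-zeroʳ (δ k i) (A i j)))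
        (δ-*-δ {i = k} {k = k} (A k k) ≡.refl ≡.refl)

  sum₂-tail : ∀ {n} (F : Matrix (suc n)) → (∀ j → F 0F j ≈ 0#) → (∀ i → F i 0F ≈ 0#) →
              sum₂ F ≈ sum₂ (λ i j → F (suc i) (suc j))
  sum₂-tail F row col = begin-equality
    sum (F 0F) + sum (λ i → F (suc i) 0F + sum (F (suc i) ∘ suc))
      ≈⟨ +-cong (sum-zero row) (sum-cong-≋ (λ i → trans (+-congʳ (col (suc i))) (+-identityˡ _))) ⟩
    0# + sum₂ (λ i j → F (suc i) (suc j))
      ≈⟨ +-identityˡ _ ⟩
    sum₂ (λ i j → F (suc i) (suc j))
      ∎

  -- With a = A₀₀, a A is the rank-one matrix of the first row of A plus the
  -- complement, whose first row and column vanish.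
  frobenius-nonneg : ∀ {n} {A B : Matrix n} → PSD A → PSD B → 0# ≤ sum₂ (λ i j → A i j * B i j)
  frobenius-nonneg {zero}  _ _ = ≤-refl
  frobenius-nonneg {suc n} {A} {B} psdA psdB with A 0F 0F ≟ 0#
  ... | yes a≈0 = ≤-respʳ-≈
    (sym (sum₂-tail (λ i j → A i j * B i j)
      (λ j → trans (*-congʳ (A₀ⱼ≈0 j)) (zeroˡ _))
      (λ i → trans (*-congʳ (trans (PSD.symmetric psdA i 0F) (A₀ⱼ≈0 i))) (zeroˡ _))))
    (frobenius-nonneg (PSD-pullback suc psdA) (PSD-pullback suc psdB))
    where A₀ⱼ≈0 = PSD-zero-row psdA a≈0
  ... | no  a≉0 = *-cancelˡ-nonneg (nonneg∧≉0⇒positive (PSD-diagonal psdA 0F) a≉0) (begin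
    0#
      -- Pairing B with the rank-one part gives the form of B at the first row of A; the pairing
      -- with the complement is the induction hypothesis.
      ≤⟨ +-nonneg (PSD.nonneg psdB (λ i → A 0F i))
                  (frobenius-nonneg (PSD-pullback suc (PSD-complement psdA 0F)) (PSD-pullback suc psdB)) ⟩
    sum₂ (λ i j → A 0F i * B i j * A 0F j) + sum₂ (λ i j → C (suc i) (suc j) * B (suc i) (suc j))
      ≈⟨ +-congˡ (sum₂-tail (λ i j → C i j * B i j)
           (λ j → trans (*-congʳ (-‿inverseʳ _)) (zeroˡ _))
           (λ i → trans (*-congʳ (trans (+-congʳ (*-comm _ _)) (-‿inverseʳ _))) (zeroˡ _))) ⟨
    sum₂ (λ i j → A 0F i * B i j * A 0F j) + sum₂ (λ i j → C i j * B i j)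
      ≈⟨ sum₂-distrib-+ (λ i j → A 0F i * B i j * A 0F j) (λ i j → C i j * B i j) ⟨
    sum₂ (λ i j → A 0F i * B i j * A 0F j + C i j * B i j)
      ≈⟨ sum₂-cong (λ i j → trans
           (+-congʳ (*-congʳ (*-congʳ (PSD.symmetric psdA 0F i))))
           (solve 5 (λ a u v w b → u :* b :* v :+ (a :* w :- u :* v) :* b := a :* (w :* b)) refl
              (A 0F 0F) (A i 0F) (A 0F j) (A i j) (B i j))) ⟩
    sum₂ (λ i j → A 0F 0F * (A i j * B i j))
      ≈⟨ *-distribˡ-sum₂ (A 0F 0F) (λ i j → A i j * B i j) ⟨
    A 0F 0F * sum₂ (λ i j → A i j * B i j)
      ∎)
    where C = complement A 0F

  -- With D the diagonal matrix of x, the form of the entrywise product at x is the Frobenius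
  -- pairing of A with DBD.
  PSD-hadamard : ∀ {n} {A B : Matrix n} → PSD A → PSD B → PSD (λ i j → A i j * B i j)
  PSD-hadamard {A = A} {B} psdA psdB = record
    { symmetric = λ i j → *-cong (PSD.symmetric psdA i j) (PSD.symmetric psdB i j)
    ; nonneg    = λ x → ≤-respʳ-≈
        (sum₂-cong (λ i j → solve 4 (λ a x b y → a :* (x :* b :* y) := x :* (a :* b) :* y) refl
                              (A i j) (x i) (B i j) (x j)))
        (frobenius-nonneg psdA (scaled x))
    }
    where
    scaled : ∀ x → PSD (λ i j → x i * B i j * x j)
    scaled x = record
      { symmetric = λ i j → trans (*-congʳ (*-congˡ (PSD.symmetric psdB i j)))
          (solve 3 (λ x b y → x :* b :* y := y :* b :* x) refl (x i) (B j i) (x j))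
      ; nonneg    = λ y → ≤-respʳ-≈
          (sum₂-cong (λ i j → solve 5 (λ y x b z w → y :* x :* b :* (z :* w) := y :* (x :* b :* w) :* z) refl
                                (y i) (x i) (B i j) (y j) (x j)))
          (PSD.nonneg psdB (λ i → y i * x i))
      }

  -- Comparison of quadratic forms on a bipartite graph

  ∣x∣≈±x : ∀ x → ∣ x ∣ ≈ x ⊎ ∣ x ∣ ≈ - x
  ∣x∣≈±x x = [ (λ 0≤x → inj₁ (x≥0⇒∣x∣≈x 0≤x)) , (λ x≤0 → inj₂ (x≤0⇒∣x∣≈-x x≤0)) ]′ (total 0# x)

  -- The product x y is ∣x∣∣y∣ up to sign, so in each sign case the difference of the two sides is
  -- ∣x∣∣y∣ times c + b or c - b.
  ±b≤c⇒-c∣x∣∣y∣≤xby : ∀ {b c} → b ≤ c → - b ≤ c → ∀ x y → - (c * (∣ x ∣ * ∣ y ∣)) ≤ x * b * y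
  ±b≤c⇒-c∣x∣∣y∣≤xby {b} {c} b≤c -b≤c x y = 0≤y-x⇒x≤y (bound (∣x∣≈±x x) (∣x∣≈±x y))
    where
    p = ∣ x ∣
    q = ∣ y ∣
    pq≥0 = *-nonneg (∣-∣-nonneg x) (∣-∣-nonneg y)
    plus : 0# ≤ p * q * (c - b)
    plus = *-nonneg pq≥0 (x≤y⇒0≤y-x b≤c)
    minus : 0# ≤ p * q * (c - - b)
    minus = *-nonneg pq≥0 (x≤y⇒0≤y-x -b≤c)
    reduce : ∀ {s} → x * y ≈ s → 0# ≤ s * b + c * (p * q) → 0# ≤ x * b * y - - (c * (p * q))
    reduce {s} xy≈s = ≤-respʳ-≈ (trans (+-congʳ (*-congʳ (sym xy≈s)))
      (solve 4 (λ x b y d → x :* y :* b :+ d := x :* b :* y :- :- d) refl x b y (c * (p * q))))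
    bound : _ → _ → 0# ≤ x * b * y - - (c * (p * q))
    bound (inj₁ p≈x)  (inj₁ q≈y)  = reduce (sym (*-cong p≈x q≈y))
      (≤-respʳ-≈ (solve 4 (λ p q b c → p :* q :* (c :- :- b) := p :* q :* b :+ c :* (p :* q)) refl p q b c) minus)
    bound (inj₂ p≈-x) (inj₂ q≈-y) = reduce
      (trans (solve 2 (λ x y → x :* y := :- x :* :- y) refl x y) (sym (*-cong p≈-x q≈-y)))
      (≤-respʳ-≈ (solve 4 (λ p q b c → p :* q :* (c :- :- b) := p :* q :* b :+ c :* (p :* q)) refl p q b c) minus)
    bound (inj₁ p≈x)  (inj₂ q≈-y) = reduce
      (trans (solve 2 (λ x y → x :* y := :- (x :* :- y)) refl x y) (-‿cong (sym (*-cong p≈x q≈-y))))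
      (≤-respʳ-≈ (solve 4 (λ p q b c → p :* q :* (c :- b) := :- (p :* q) :* b :+ c :* (p :* q)) refl p q b c) plus)
    bound (inj₂ p≈-x) (inj₁ q≈y)  = reduce
      (trans (solve 2 (λ x y → x :* y := :- (:- x :* y)) refl x y) (-‿cong (sym (*-cong p≈-x q≈y))))
      (≤-respʳ-≈ (solve 4 (λ p q b c → p :* q :* (c :- b) := :- (p :* q) :* b :+ c :* (p :* q)) refl p q b c) plus)

  sign : Bool → Carrier
  sign true  = 1#
  sign false = - 1#

  sign-≡ : ∀ s → sign s * sign s ≈ 1#
  sign-≡ true  = *-identityˡ 1#
  sign-≡ false = solve 0 (:- con (+ 1) :* :- con (+ 1) := con (+ 1)) refl

  sign-≢ : ∀ {s t} → s ≢ t → sign s * sign t ≈ - 1#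
  sign-≢ {true}  {true}  s≢t = contradiction ≡.refl s≢t
  sign-≢ {true}  {false} _   = *-identityˡ _
  sign-≢ {false} {true}  _   = *-identityʳ _
  sign-≢ {false} {false} s≢t = contradiction ≡.refl s≢t

  -- Testing A on the vector ± wᵢ∣xᵢ∣, with opposite signs on the two sides of G,
  -- gives a lower bound for the quadratic form of B at x.
  PSD-bipartite-≤ : ∀ {n} {G : Graph n} {I A B} (w : Fin n → Carrier) → Bipartite G → 𝒫 G I A →
    (∀ i j → B i j ≈ B j i) →
    (∀ i → w i * A i i * w i ≤ B i i) →
    (∀ i j → B i j ≤ w i * A i j * w j) →
    (∀ i j → - B i j ≤ w i * A i j * w j) →
    PSD B
  PSD-bipartite-≤ {n} {G} {I} {A} {B} w (side , crosses) A∈𝒫 B-sym diagonal upper lower = record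
    { symmetric = B-sym
    ; nonneg    = λ x → ≤-trans (PSD.nonneg psd (y x)) (sum₂-mono-≤ (termwise x))
    }
    where
    open 𝒫 A∈𝒫
    y : (Fin n → Carrier) → Fin n → Carrier
    y x i = sign (side i) * (w i * ∣ x i ∣)

    factor : ∀ x i j → y x i * A i j * y x j ≈
                       sign (side i) * sign (side j) * (w i * A i j * w j * (∣ x i ∣ * ∣ x j ∣))
    factor x i j = solve 7 (λ s w p a t v q → s :* (w :* p) :* a :* (t :* (v :* q)) :=
                                              s :* t :* (w :* a :* v :* (p :* q))) refl
      (sign (side i)) (w i) (∣ x i ∣) (A i j) (sign (side j)) (w j) (∣ x j ∣)

    termwise : ∀ x i j → y x i * A i j * y x j ≤ x i * B i j * x j
    termwise x i j with i ≟ᶠ j | side i Bool.≟ side j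
    ... | yes ≡.refl | _ = begin
      y x i * A i i * y x i                           ≈⟨ factor x i i ⟩
      sign (side i) * sign (side i) * (w i * A i i * w i * (∣ x i ∣ * ∣ x i ∣))
        ≈⟨ trans (*-congʳ (sign-≡ (side i))) (*-identityˡ _) ⟩
      w i * A i i * w i * (∣ x i ∣ * ∣ x i ∣)         ≈⟨ *-congˡ (∣x∣*∣x∣≈x*x (x i)) ⟩
      w i * A i i * w i * (x i * x i)                 ≈⟨ *-comm _ _ ⟩
      x i * x i * (w i * A i i * w i)                 ≤⟨ *-monoˡ-≤ (x*x-nonneg (x i)) (diagonal i) ⟩
      x i * x i * B i i                               ≈⟨ solve 2 (λ x b → x :* x :* b := x :* b :* x) refl (x i) (B i i) ⟩
      x i * B i i * x i                               ∎
    -- Distinct vertices on one side are not adjacent, so `A` vanishes there, and the two bounds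
    -- squeeze `B` to zero as well.
    ... | no i≢j | yes same = ≤-reflexive (begin-equality
      y x i * A i j * y x j   ≈⟨ *-congʳ (trans (*-congˡ A≈0) (zeroʳ _)) ⟩
      0# * y x j              ≈⟨ zeroˡ _ ⟩
      0#                      ≈⟨ zeroˡ _ ⟨
      0# * x j                ≈⟨ *-congʳ (trans (*-congˡ B≈0) (zeroʳ _)) ⟨
      x i * B i j * x j       ∎)
      where
      A≈0 : A i j ≈ 0#
      A≈0 = support i j i≢j (λ i∼j → crosses i∼j same)
      wAw≈0 : w i * A i j * w j ≈ 0#
      wAw≈0 = trans (*-congʳ (trans (*-congˡ A≈0) (zeroʳ _))) (zeroˡ _)
      B≈0 : B i j ≈ 0#
      B≈0 = antisym (≤-respʳ-≈ wAw≈0 (upper i j))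
        (0≤y-x⇒x≤y (≤-respʳ-≈ (solve 1 (λ b → con (+ 0) :- :- b := b :- con (+ 0)) refl (B i j))
          (x≤y⇒0≤y-x (≤-respʳ-≈ wAw≈0 (lower i j)))))
    ... | no i≢j | no opposite = begin
      y x i * A i j * y x j                           ≈⟨ factor x i j ⟩
      sign (side i) * sign (side j) * (w i * A i j * w j * (∣ x i ∣ * ∣ x j ∣))
        ≈⟨ trans (*-congʳ (sign-≢ opposite)) (-1*x≈-x _) ⟩
      - (w i * A i j * w j * (∣ x i ∣ * ∣ x j ∣))     ≤⟨ ±b≤c⇒-c∣x∣∣y∣≤xby (upper i j) (lower i j) (x i) (x j) ⟩
      x i * B i j * x j                               ∎

  -- Inheritance of preservers by subgraphs

  module _ {f : Carrier → Carrier → Carrier} (f-isPower : ∀ α → IsPower α (f α)) where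
    open module f {α} = IsPower (f-isPower α)

    image-∈𝒫 : ∀ {n} {G : Graph n} {I α A} → 𝒫 G I A → PSD (f α [ A ]) → 𝒫 G U (f α [ A ])
    image-∈𝒫 A∈𝒫 psd = record
      { psd       = psd
      ; entries∈I = λ _ _ → _
      ; support   = λ i j i≢j i≁j → zero-cong (𝒫.support A∈𝒫 i j i≢j i≁j)
      }

    -- A matrix on H is padded by zeros to one on G, transformed there, and restricted back along
    -- `v`. The subgraph may be non-induced because `𝒫` only prescribes zeros, and pairs that are
    -- not edges of G pull back to pairs that are not edges of H.
    Preserving-⊑ : ∀ {m n} {H : Graph m} {G : Graph n} {I : Pred Carrier 0ℓ} →
      I 0# → (∀ {x y} → x ≈ y → I x → I y) → H ⊑ G → Preserving f G I ⊆ Preserving f H I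
    Preserving-⊑ {m} {n} {H} {G} {I} 0∈I I-resp-≈ (v , v-injective , v-adjacent) {α} preserves A A∈𝒫 =
      image-∈𝒫 A∈𝒫 (PSD-resp-≈ (λ k l → f.cong (inside k l)) (PSD-pullback v (𝒫.psd (preserves E E∈𝒫))))
      where
      open 𝒫 A∈𝒫
      T : Fin m → Fin n → Carrier
      T k p = δ (v k) p
      -- The extension of A by zero along v.
      E = T ᵀ⟨ A ⟩ T

      inside : ∀ k l → E (v k) (v l) ≈ A k l
      inside k l = trans
        (sum₂-single (λ i j → δ (v i) (v k) * A i j * δ (v j) (v l)) k l
          (λ i j k≢i → δ-*-zeroˡ (A i j) (δ (v j) (v l)) (λ eq → k≢i (≡.sym (v-injective eq))))
          (λ i j l≢j → δ-*-zeroʳ (δ (v i) (v k)) (A i j) (λ eq → l≢j (≡.sym (v-injective eq)))))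
        (δ-*-δ {i = v k} {k = v l} (A k l) ≡.refl ≡.refl)

      entry : ∀ p q → (∃₂ λ k l → v k ≡ p × v l ≡ q) ⊎ E p q ≈ 0#
      entry p q with any? (λ k → v k ≟ᶠ p) | any? (λ l → v l ≟ᶠ q)
      ... | yes (k , vk≡p) | yes (l , vl≡q) = inj₁ (k , l , vk≡p , vl≡q)
      ... | no  p∉v | _ = inj₂ (sum-zero (λ i → sum-zero (λ j →
        δ-*-zeroˡ (A i j) (T j q) (λ eq → p∉v (i , eq)))))
      ... | yes _ | no q∉v = inj₂ (sum-zero (λ i → sum-zero (λ j →
        δ-*-zeroʳ (T i p) (A i j) (λ eq → q∉v (j , eq)))))

      E∈𝒫 : 𝒫 G I E
      E∈𝒫 = record
        { psd       = PSD-congruence T psd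
        ; entries∈I = λ p q → case entry p q of λ where
            (inj₁ (k , l , ≡.refl , ≡.refl)) → I-resp-≈ (sym (inside k l)) (entries∈I k l)
            (inj₂ E≈0)                       → I-resp-≈ (sym E≈0) 0∈I
        ; support   = λ p q p≢q p≁q → case entry p q of λ where
            (inj₁ (k , l , ≡.refl , ≡.refl)) → trans (inside k l)
              (support k l (λ k≡l → p≢q (≡.cong v k≡l)) (λ k∼l → p≁q (v-adjacent k∼l)))
            (inj₂ E≈0)                       → E≈0
        }

  -- Test matrices and upper bounds

  2^-cancel-≤ : ∀ {α β} → 2# ^ α ≤ 2# ^ β → α ≤ β
  2^-cancel-≤ {α} {β} 2^α≤2^β with total α β
  ... | inj₁ α≤β = α≤β
  ... | inj₂ β≤α with β ≟ α
  ...   | yes β≈α = ≤-reflexive (sym β≈α)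
  ...   | no  β≉α = contradiction 2^α≤2^β (<⇒≱ (^-monoʳ-< (x<x+1 1#) (β≤α , β≉α)))

  -- Its Schur complement at the centre is d - 2, so d = 2 is the extreme case, the signless
  -- Laplacian of K₁₂. The other entries are 0 or 1 and hence fixed by every power function, which
  -- therefore only moves d from 2 to 2^α.
  star : Carrier → Matrix 3
  star d 0F 0F = d
  star d 0F 1F = 1#
  star d 0F 2F = 1#
  star d 1F 0F = 1#
  star d 1F 1F = 1#
  star d 1F 2F = 0#
  star d 2F 0F = 1#
  star d 2F 1F = 0#
  star d 2F 2F = 1#

  PSD-star-2 : PSD (star 2#)
  PSD-star-2 = record
    { symmetric = λ { 0F 0F → refl ; 0F 1F → refl ; 0F 2F → refl
                    ; 1F 0F → refl ; 1F 1F → refl ; 1F 2F → refl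
                    ; 2F 0F → refl ; 2F 1F → refl ; 2F 2F → refl }
    ; nonneg    = λ x → ≤-respʳ-≈
        (solve 3 (λ x y z →
           let o = con (+ 0) ; e = con (+ 1) in
           (x :+ y) :* (x :+ y) :+ (x :+ z) :* (x :+ z) :=
           (x :* con (+ 2) :* x :+ (x :* e :* y :+ (x :* e :* z :+ o))) :+
           ((y :* e :* x :+ (y :* e :* y :+ (y :* o :* z :+ o))) :+
           ((z :* e :* x :+ (z :* o :* y :+ (z :* e :* z :+ o))) :+ o)))
           refl (x 0F) (x 1F) (x 2F))
        (+-nonneg (x*x-nonneg (x 0F + x 1F)) (x*x-nonneg (x 0F + x 2F)))
    }

  PSD-star⇒2≤ : ∀ {d} → PSD (star d) → 2# ≤ d
  PSD-star⇒2≤ {d} psd = 0≤y-x⇒x≤y (≤-respʳ-≈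
    (solve 1 (λ d →
       let o = con (+ 0) ; e = con (+ 1) ; m = :- con (+ 1) in
       (e :* d :* e :+ (e :* e :* m :+ (e :* e :* m :+ o))) :+
       ((m :* e :* e :+ (m :* e :* m :+ (m :* o :* m :+ o))) :+
       ((m :* e :* e :+ (m :* o :* m :+ (m :* e :* m :+ o))) :+ o)) :=
       d :- con (+ 2)) refl d)
    -- The vector (1, -1, -1) spans the kernel in the extreme case d = 2.
    (PSD.nonneg psd (λ { 0F → 1# ; (suc _) → - 1# })))

  star-∈𝒫 : ∀ {I : Pred Carrier 0ℓ} → I 0# → I 1# → I 2# → 𝒫 (K 1 2) I (star 2#)
  star-∈𝒫 0∈I 1∈I 2∈I = record
    { psd       = PSD-star-2
    ; entries∈I = λ { 0F 0F → 2∈I ; 0F 1F → 1∈I ; 0F 2F → 1∈I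
                    ; 1F 0F → 1∈I ; 1F 1F → 1∈I ; 1F 2F → 0∈I
                    ; 2F 0F → 1∈I ; 2F 1F → 0∈I ; 2F 2F → 1∈I }
    ; support   = λ where
        0F 0F 0≢0 _   → contradiction ≡.refl 0≢0
        0F 1F _   0≁1 → contradiction (inj₁ (s≤s z≤n , s≤s z≤n)) 0≁1
        0F 2F _   0≁2 → contradiction (inj₁ (s≤s z≤n , s≤s z≤n)) 0≁2
        1F 0F _   1≁0 → contradiction (inj₂ (s≤s z≤n , s≤s z≤n)) 1≁0
        1F 1F 1≢1 _   → contradiction ≡.refl 1≢1
        1F 2F _   _   → refl
        2F 0F _   2≁0 → contradiction (inj₂ (s≤s z≤n , s≤s z≤n)) 2≁0
        2F 1F _   _   → refl
        2F 2F 2≢2 _   → contradiction ≡.refl 2≢2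
    }

  -- With N the upper right 2 × 2 block, positivity means that d I - NᵀN is positive. For s = -1 the
  -- columns of N are orthogonal and NᵀN = 2 I, so d = 2 suffices; for s = 1 the matrix NᵀN has
  -- eigenvalue 4. Since `φ α` sends -1 to 1 and 2 to 2^α, it leads from the first case to the
  -- second.
  cycle : Carrier → Carrier → Matrix 4
  cycle s d 0F 0F = 1#
  cycle s d 0F 1F = 0#
  cycle s d 0F 2F = 1#
  cycle s d 0F 3F = 1#
  cycle s d 1F 0F = 0#
  cycle s d 1F 1F = 1#
  cycle s d 1F 2F = 1#
  cycle s d 1F 3F = s
  cycle s d 2F 0F = 1#
  cycle s d 2F 1F = 1#
  cycle s d 2F 2F = d
  cycle s d 2F 3F = 0#
  cycle s d 3F 0F = 1#
  cycle s d 3F 1F = s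
  cycle s d 3F 2F = 0#
  cycle s d 3F 3F = d

  PSD-cycle : PSD (cycle (- 1#) 2#)
  PSD-cycle = record
    { symmetric = λ { 0F 0F → refl ; 0F 1F → refl ; 0F 2F → refl ; 0F 3F → refl
                    ; 1F 0F → refl ; 1F 1F → refl ; 1F 2F → refl ; 1F 3F → refl
                    ; 2F 0F → refl ; 2F 1F → refl ; 2F 2F → refl ; 2F 3F → refl
                    ; 3F 0F → refl ; 3F 1F → refl ; 3F 2F → refl ; 3F 3F → refl }
    ; nonneg    = λ x → ≤-respʳ-≈
        (solve 4 (λ x y z w →
           let o = con (+ 0) ; e = con (+ 1) ; m = :- e ; t = con (+ 2) in
           (x :+ z :+ w) :* (x :+ z :+ w) :+ (y :+ z :- w) :* (y :+ z :- w) :=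
           (x :* e :* x :+ (x :* o :* y :+ (x :* e :* z :+ (x :* e :* w :+ o)))) :+
           ((y :* o :* x :+ (y :* e :* y :+ (y :* e :* z :+ (y :* m :* w :+ o)))) :+
           ((z :* e :* x :+ (z :* e :* y :+ (z :* t :* z :+ (z :* o :* w :+ o)))) :+
           ((w :* e :* x :+ (w :* m :* y :+ (w :* o :* z :+ (w :* t :* w :+ o)))) :+ o))))
           refl (x 0F) (x 1F) (x 2F) (x 3F))
        (+-nonneg (x*x-nonneg (x 0F + x 2F + x 3F)) (x*x-nonneg (x 1F + x 2F - x 3F)))
    }

  PSD-cycle⇒4≤ : ∀ {d} → PSD (cycle 1# d) → 2# * 2# ≤ d
  PSD-cycle⇒4≤ {d} psd = 0≤y-x⇒x≤y (*-cancelˡ-nonneg 0<2 (≤-respʳ-≈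
    (solve 1 (λ d →
       let o = con (+ 0) ; e = con (+ 1) ; m = :- e ; t = con (+ 2) in
       (t :* e :* t :+ (t :* o :* t :+ (t :* e :* m :+ (t :* e :* m :+ o)))) :+
       ((t :* o :* t :+ (t :* e :* t :+ (t :* e :* m :+ (t :* e :* m :+ o)))) :+
       ((m :* e :* t :+ (m :* e :* t :+ (m :* d :* m :+ (m :* o :* m :+ o)))) :+
       ((m :* e :* t :+ (m :* e :* t :+ (m :* o :* m :+ (m :* d :* m :+ o)))) :+ o))) :=
       t :* (d :- t :* t)) refl d)
    -- The vector (2, 2, -1, -1) spans the kernel in the extreme case d = 4.
    (PSD.nonneg psd (λ { 0F → 2# ; 1F → 2# ; (suc (suc _)) → - 1# }))))

  cycle-∈𝒫 : 𝒫 (K 2 2) U (cycle (- 1#) 2#)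
  cycle-∈𝒫 = record
    { psd       = PSD-cycle
    ; entries∈I = λ _ _ → _
    ; support   = λ where
        0F 0F 0≢0 _   → contradiction ≡.refl 0≢0
        0F 1F _   _   → refl
        0F 2F _   0≁2 → contradiction (inj₁ (s≤s z≤n , s≤s (s≤s z≤n))) 0≁2
        0F 3F _   0≁3 → contradiction (inj₁ (s≤s z≤n , s≤s (s≤s z≤n))) 0≁3
        1F 0F _   _   → refl
        1F 1F 1≢1 _   → contradiction ≡.refl 1≢1
        1F 2F _   1≁2 → contradiction (inj₁ (s≤s (s≤s z≤n) , s≤s (s≤s z≤n))) 1≁2
        1F 3F _   1≁3 → contradiction (inj₁ (s≤s (s≤s z≤n) , s≤s (s≤s z≤n))) 1≁3
        2F 0F _   2≁0 → contradiction (inj₂ (s≤s z≤n , s≤s (s≤s z≤n))) 2≁0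
        2F 1F _   2≁1 → contradiction (inj₂ (s≤s (s≤s z≤n) , s≤s (s≤s z≤n))) 2≁1
        2F 2F 2≢2 _   → contradiction ≡.refl 2≢2
        2F 3F _   _   → refl
        3F 0F _   3≁0 → contradiction (inj₂ (s≤s z≤n , s≤s (s≤s z≤n))) 3≁0
        3F 1F _   3≁1 → contradiction (inj₂ (s≤s (s≤s z≤n) , s≤s (s≤s z≤n))) 3≁1
        3F 2F _   _   → refl
        3F 3F 3≢3 _   → contradiction ≡.refl 3≢3
    }

  K₁₂⊑⇒Preserving⊆[1,∞⟩ : ∀ {f} → (∀ α → IsPower α (f α)) → ∀ {n} {G : Graph n} {I : Pred Carrier 0ℓ} →
    I 0# → I 1# → I 2# → (∀ {x y} → x ≈ y → I x → I y) →
    K 1 2 ⊑ G → Preserving f G I ⊆ [ 1# ,∞⟩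
  K₁₂⊑⇒Preserving⊆[1,∞⟩ {f} f-isPower {G = G} 0∈I 1∈I 2∈I I-resp-≈ K₁₂⊑G {α} α∈ = 2^-cancel-≤
    (≤-respˡ-≈ (sym (^-identityʳ 0<2)) (PSD-star⇒2≤ (PSD-resp-≈ values (𝒫.psd
      (Preserving-⊑ f-isPower {H = K 1 2} {G = G} 0∈I I-resp-≈ K₁₂⊑G α∈ (star 2#) (star-∈𝒫 0∈I 1∈I 2∈I))))))
    where
    open IsPower (f-isPower α)
    values : ∀ i j → f α (star 2# i j) ≈ star (2# ^ α) i j
    values 0F 0F = at-pos 0<2
    values 0F 1F = at-1
    values 0F 2F = at-1
    values 1F 0F = at-1
    values 1F 1F = at-1
    values 1F 2F = at-0
    values 2F 0F = at-1
    values 2F 1F = at-0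
    values 2F 2F = at-1

  K₂₂⊑⇒ℋφ⊆[2,∞⟩ : ∀ {n} {G : Graph n} → K 2 2 ⊑ G → ℋφ G ⊆ [ 2# ,∞⟩
  K₂₂⊑⇒ℋφ⊆[2,∞⟩ {G = G} K₂₂⊑G {α} α∈ = 2^-cancel-≤
    (≤-respˡ-≈ (sym (x^2≈x*x 0<2)) (PSD-cycle⇒4≤ (PSD-resp-≈ values (𝒫.psd
      (Preserving-⊑ φ-isPower {H = K 2 2} {G = G} _ _ K₂₂⊑G α∈ (cycle (- 1#) 2#) cycle-∈𝒫)))))
    where
    open IsPower (φ-isPower α)
    at--1 : φ α (- 1#) ≈ 1#
    at--1 = trans (φ-at-≉0 α -1≉0)
      (trans (^-cong (trans (x≤0⇒∣x∣≈-x -1≤0) (-‿involutive 1#)) refl) (1^α≈1 α))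
      where
      -1≤0 : - 1# ≤ 0#
      -1≤0 = 0≤y-x⇒x≤y (≤-respʳ-≈ (solve 0 (con (+ 1) := con (+ 0) :- :- con (+ 1)) refl) 0≤1)
      -1≉0 : ¬ - 1# ≈ 0#
      -1≉0 -1≈0 = 0≉1 (trans (sym (-‿inverseʳ 1#)) (trans (+-congˡ -1≈0) (+-identityʳ 1#)))
    values : ∀ i j → φ α (cycle (- 1#) 2# i j) ≈ cycle 1# (2# ^ α) i j
    values 0F 0F = at-1
    values 0F 1F = at-0
    values 0F 2F = at-1
    values 0F 3F = at-1
    values 1F 0F = at-0
    values 1F 1F = at-1
    values 1F 2F = at-1
    values 1F 3F = at--1
    values 2F 0F = at-1
    values 2F 1F = at-1
    values 2F 2F = at-pos 0<2
    values 2F 3F = at-0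
    values 3F 0F = at-1
    values 3F 1F = at--1
    values 3F 2F = at-0
    values 3F 3F = at-pos 0<2

  -- Lower bounds by weighted comparison

  power-split : ∀ {α β} → β + β ≈ α - 1# → ∀ {x} → 0# ≤ x → power β x * x * power β x ≈ power α x
  power-split {α} {β} β+β≈α-1 {x} 0≤x = case x ≟ 0# of λ where
      (yes x≈0) → trans (*-congʳ (trans (*-congˡ x≈0) (zeroʳ _))) (trans (zeroˡ _) (sym (^α.zero-cong x≈0)))
      (no  x≉0) → let 0<x = nonneg∧≉0⇒positive 0≤x x≉0 in begin-equality
        power β x * x * power β x     ≈⟨ *-cong (*-cong (^β.at-pos 0<x) (sym (^-identityʳ 0<x))) (^β.at-pos 0<x) ⟩
        x ^ β * x ^ 1# * x ^ β        ≈⟨ *-congʳ (^-distribˡ-+-* β 1# 0<x) ⟨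
        x ^ (β + 1#) * x ^ β          ≈⟨ ^-distribˡ-+-* (β + 1#) β 0<x ⟨
        x ^ (β + 1# + β)              ≈⟨ ^-cong refl (begin-equality
          β + 1# + β                    ≈⟨ solve 1 (λ β → β :+ con (+ 1) :+ β := β :+ β :+ con (+ 1)) refl β ⟩
          β + β + 1#                    ≈⟨ +-congʳ β+β≈α-1 ⟩
          α - 1# + 1#                   ≈⟨ solve 1 (λ α → α :- con (+ 1) :+ con (+ 1) := α) refl α ⟩
          α                             ∎) ⟩
        x ^ α                         ≈⟨ ^α.at-pos 0<x ⟨
        power α x                     ∎
    where
    module ^α = IsPower (power-isPower α)
    module ^β = IsPower (power-isPower β)

  -- Writing x^α as x (x²)^β lets the minor inequality x² ≤ y z enter through monotonicity of the
  -- β-th power. Here x is an off-diagonal entry and y, z the matching diagonal ones; on the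
  -- diagonal `power-split` gives equality.
  power-split-≤ : ∀ {α β} → β + β ≈ α - 1# → 0# ≤ β → ∀ {x y z} → 0# ≤ x → 0# ≤ y → 0# ≤ z →
                  x * x ≤ y * z → power α x ≤ power β y * x * power β z
  power-split-≤ {α} {β} β+β≈α-1 0≤β {x} {y} {z} 0≤x 0≤y 0≤z x*x≤y*z = case x ≟ 0# of λ where
      (yes x≈0) → ≤-respˡ-≈ (sym (IsPower.zero-cong (power-isPower α) x≈0))
                            (*-nonneg (*-nonneg (^β.nonneg 0≤y) 0≤x) (^β.nonneg 0≤z))
      (no  x≉0) →
        let 0<x = nonneg∧≉0⇒positive 0≤x x≉0
            -- The laws of `_^_` hold for positive bases only; a nonzero entry x makes y and z
            -- nonzero by the minor inequality.
            y*z≉0 = λ y*z≈0 → x≉0 (x*x≤0⇒x≈0 (≤-respʳ-≈ y*z≈0 x*x≤y*z))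
            0<y = nonneg∧≉0⇒positive 0≤y (λ y≈0 → y*z≉0 (trans (*-congʳ y≈0) (zeroˡ z)))
            0<z = nonneg∧≉0⇒positive 0≤z (λ z≈0 → y*z≉0 (trans (*-congˡ z≈0) (zeroʳ y)))
        in begin
          power α x                     ≈⟨ power-split β+β≈α-1 0≤x ⟨
          power β x * x * power β x     ≈⟨ *-cong (*-congʳ (^β.at-pos 0<x)) (^β.at-pos 0<x) ⟩
          x ^ β * x * x ^ β             ≈⟨ move (x ^ β) x (x ^ β) ⟩
          x * (x ^ β * x ^ β)           ≈⟨ *-congˡ (^-distribʳ-* β 0<x 0<x) ⟨
          x * (x * x) ^ β               ≤⟨ *-monoˡ-≤ 0≤x (^-monoˡ-≤ β 0≤β (*-positive 0<x 0<x) x*x≤y*z) ⟩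
          x * (y * z) ^ β               ≈⟨ *-congˡ (^-distribʳ-* β 0<y 0<z) ⟩
          x * (y ^ β * z ^ β)           ≈⟨ move (y ^ β) x (z ^ β) ⟨
          y ^ β * x * z ^ β             ≈⟨ *-cong (*-congʳ (^β.at-pos 0<y)) (^β.at-pos 0<z) ⟨
          power β y * x * power β z     ∎
    where
    module ^β = IsPower (power-isPower β)
    move : ∀ u x v → u * x * v ≈ x * (u * v)
    move = solve 3 (λ u x v → u :* x :* v := x :* (u :* v)) refl

  [1,∞⟩⊆ℋ : ∀ {n} {G : Graph n} → Bipartite G → [ 1# ,∞⟩ ⊆ ℋ G
  [1,∞⟩⊆ℋ {G = G} bipartite {α} 1≤α A A∈𝒫 with half (α - 1#)
  ... | β , β+β≈α-1 = image-∈𝒫 power-isPower A∈𝒫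
    (PSD-bipartite-≤ (λ i → power β (A i i)) bipartite A∈𝒫
      (λ i j → ^α.cong (PSD.symmetric psd i j))
      (λ i → ≤-reflexive (power-split β+β≈α-1 (entries∈I i i)))
      upper
      (λ i j → ≤-trans (0≤x⇒-x≤x (^α.nonneg (entries∈I i j))) (upper i j)))
    where
    open 𝒫 A∈𝒫
    module ^α = IsPower (power-isPower α)
    0≤β : 0# ≤ β
    0≤β = 2*x-nonneg⇒x-nonneg (≤-respʳ-≈ (sym β+β≈α-1) (x≤y⇒0≤y-x 1≤α))
    upper : ∀ i j → power α (A i j) ≤ power β (A i i) * A i j * power β (A j j)
    upper i j = power-split-≤ β+β≈α-1 0≤β (entries∈I i j) (entries∈I i i) (entries∈I j j) (PSD-minor psd i j)

  [2,∞⟩⊆ℋφ : ∀ {n} {G : Graph n} → Bipartite G → [ 2# ,∞⟩ ⊆ ℋφ G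
  [2,∞⟩⊆ℋφ {G = G} bipartite {α} 2≤α A A∈𝒫 with half α
  ... | β , β+β≈α = image-∈𝒫 φ-isPower A∈𝒫 (PSD-resp-≈
    (λ i j → φ-double β+β≈α (A i j))
    (𝒫.psd ([1,∞⟩⊆ℋ {G = G} bipartite 1≤β (λ i j → A i j * A i j) A∘A∈𝒫)))
    where
    open 𝒫 A∈𝒫
    A∘A∈𝒫 : 𝒫 G [ 0# ,∞⟩ (λ i j → A i j * A i j)
    A∘A∈𝒫 = record
      { psd       = PSD-hadamard psd psd
      ; entries∈I = λ i j → x*x-nonneg (A i j)
      ; support   = λ i j i≢j i≁j → trans (*-congʳ (support i j i≢j i≁j)) (zeroˡ _)
      }
    1≤β : 1# ≤ β
    1≤β = 0≤y-x⇒x≤y (2*x-nonneg⇒x-nonneg (≤-respʳ-≈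
      (trans (+-congʳ (sym β+β≈α))
        (solve 1 (λ β → β :+ β :- con (+ 2) := β :- con (+ 1) :+ (β :- con (+ 1))) refl β))
      (x≤y⇒0≤y-x 2≤α)))

  -- The comparison matrix is φ_α[A] with unit weights. The diagonals agree because those of a
  -- positive matrix are nonnegative, and off the diagonal ψ_α is ±φ_α.
  ℋφ⊆ℋψ : ∀ {n} {G : Graph n} → Bipartite G → ℋφ G ⊆ ℋψ G
  ℋφ⊆ℋψ bipartite {α} α∈ A A∈𝒫 = image-∈𝒫 ψ-isPower A∈𝒫
    (PSD-bipartite-≤ (λ _ → 1#) bipartite (α∈ A A∈𝒫)
      (λ i j → IsPower.cong (ψ-isPower α) (PSD.symmetric psd i j))
      (λ i → ≤-reflexive (trans (1*x*1≈x _) (φ≈ψ α (PSD-diagonal psd i))))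
      (λ i j → ≤-respʳ-≈ (sym (1*x*1≈x _)) (ψ≤φ α (A i j)))
      (λ i j → ≤-respʳ-≈ (sym (1*x*1≈x _)) (-ψ≤φ α (A i j))))
    where
    open 𝒫 A∈𝒫
    1*x*1≈x : ∀ x → 1# * x * 1# ≈ x
    1*x*1≈x x = trans (*-identityʳ _) (*-identityˡ x)

  1∈ℋψ : ∀ {n} {G : Graph n} → ⟦ 1# ⟧ ⊆ ℋψ G
  1∈ℋψ {x = α} α≈1 A A∈𝒫 = image-∈𝒫 ψ-isPower A∈𝒫
    (PSD-resp-≈ (λ i j → sym (ψ-1 α≈1 (A i j))) (𝒫.psd A∈𝒫))

theorem4p10 : (ℝ : CompleteOrderedField) (pow : RealPower ℝ) →
    let open CompleteOrderedField ℝ using (1#)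
        open Powers ℝ pow
    in ∀ {n} (G : Graph n) → 3 ℕ.≤ n → Connected G → Bipartite G →
       ( ℋ G ≐ [ 1# ,∞⟩
       × ([ 2# ,∞⟩ ⊆ ℋφ G × ℋφ G ⊆ [ 1# ,∞⟩)
       × ((⟦ 1# ⟧ ∪ [ 3# ,∞⟩) ⊆ ℋψ G × ℋψ G ⊆ [ 1# ,∞⟩) )
       ×
       ( (∃[ m ] 2 ℕ.≤ m × K 2 2 ⊑ G × G ⊑ K 2 m) →
         ℋφ G ≐ [ 2# ,∞⟩
       × ((⟦ 1# ⟧ ∪ [ 2# ,∞⟩) ⊆ ℋψ G × ℋψ G ⊆ [ 1# ,∞⟩) )
theorem4p10 ℝ pow G 3≤n connected bipartite =
  ( (ℋ⊆[1,∞⟩ , [1,∞⟩⊆ℋ {G = G} bipartite)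
  , ([2,∞⟩⊆ℋφ {G = G} bipartite , ℋφ⊆[1,∞⟩)
  , ([ 1∈ℋψ {G = G} , (λ 3≤α → [2,∞⟩⊆ℋψ (≤-trans (proj₁ (x<x+1 2#)) 3≤α)) ]′ , ℋψ⊆[1,∞⟩) )
  , λ (m , 2≤m , K₂₂⊑G , G⊑K₂ₘ) →
      (K₂₂⊑⇒ℋφ⊆[2,∞⟩ {G = G} K₂₂⊑G , [2,∞⟩⊆ℋφ {G = G} bipartite)
    , ([ 1∈ℋψ {G = G} , [2,∞⟩⊆ℋψ ]′ , ℋψ⊆[1,∞⟩)
  where
  open CompleteOrderedField ℝ using (1#)
  open Powers ℝ pow
  open OrderedField ℝ
  open PowerFunctions ℝ pow
  open EntrywisePowers ℝ pow

  K₁₂⊑G : K 1 2 ⊑ G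
  K₁₂⊑G = connected⇒K₁₂⊑ {G = G} 3≤n connected

  [2,∞⟩⊆ℋψ : [ 2# ,∞⟩ ⊆ ℋψ G
  [2,∞⟩⊆ℋψ 2≤α = ℋφ⊆ℋψ {G = G} bipartite ([2,∞⟩⊆ℋφ {G = G} bipartite 2≤α)

  ℋ⊆[1,∞⟩ : ℋ G ⊆ [ 1# ,∞⟩
  ℋ⊆[1,∞⟩ = K₁₂⊑⇒Preserving⊆[1,∞⟩ power-isPower {G = G} ≤-refl 0≤1 (proj₁ 0<2) ≤-respʳ-≈ K₁₂⊑G

  ℋφ⊆[1,∞⟩ : ℋφ G ⊆ [ 1# ,∞⟩
  ℋφ⊆[1,∞⟩ = K₁₂⊑⇒Preserving⊆[1,∞⟩ φ-isPower {G = G} _ _ _ _ K₁₂⊑G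

  ℋψ⊆[1,∞⟩ : ℋψ G ⊆ [ 1# ,∞⟩
  ℋψ⊆[1,∞⟩ = K₁₂⊑⇒Preserving⊆[1,∞⟩ ψ-isPower {G = G} _ _ _ _ K₁₂⊑G
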